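{- Let $t$ be a typable expression (term, co-term or command) of $\overline\lambda\mu\tilde\mu$. If $t\to s$ in $\overline\lambda\mu\tilde\mu$, then $t^{\mathsf T}\twoheadrightarrow s^{\mathsf T}$ in $\lambda_{\mathrm{MELL}}$.
   Context: The calculus $\overline\lambda\mu\tilde\mu$ (as considered here). Types: $A,B::=\alpha\mid A\supset B$ ($\alpha$ atomic). Terms $v::=x\mid\mu\gamma.c\mid\lambda x.v$; co-terms $e::=\gamma\mid v\cdot e$; commands $c::=\langle v\mid e\rangle$; $x$ ranges over variables and $\gamma$ over co-variables. $\Gamma$ assigns types to variables and $\Theta$ assigns types to co-variables. Rules (premises $\Rightarrow$ conclusion): $\Rightarrow\Gamma,x:A\vdash x:A\mid\Theta$; $\Rightarrow\Gamma\mid\gamma:A\vdash\gamma:A,\Theta$; $\Gamma\vdash v:A\mid\Theta$ and $\Gamma\mid e:B\vdash\Theta$ $\Rightarrow$ $\Gamma\mid(v\cdot e):A\supset B\vdash\Theta$; $c:(\Gamma\vdash\gamma:B,\Theta)$ $\Rightarrow$ $\Gamma\vdash\mu\gamma.c:B\mid\Theta$; $\Gamma,x:A\vdash v:B\mid\Theta$ $\Rightarrow$ $\Gamma\vdash\lambda x.v:A\supset B\mid\Theta$; $\Gamma\vdash v:A\mid\Theta$ and $\Gamma\mid e:A\vdash\Theta$ $\Rightarrow$ $\langle v\mid e\rangle:(\Gamma\vdash\Theta)$. Reduction is the contextual closure of $\langle\lambda x.v_1\mid v_2\cdot e\rangle\mapsto\langle v_1\{x:=v_2\}\mid e\rangle$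 and $\langle\mu\gamma.c\mid e\rangle\mapsto c\{\gamma:=e\}$, with standard capture-avoiding substitution. MELL formulae: $A,B::=\alpha\mid\overline\alpha\mid A\otimes B\mid A\wp B\mid\mathbf 1\mid\bot\mid{!}A\mid{?}A$ ($\alpha$ atomic, $\overline\alpha$ its negative version, $\wp$ is "par"). Linear negation is the involution $\alpha^\perp=\overline\alpha$, $\overline\alpha^\perp=\alpha$, $(A\otimes B)^\perp=A^\perp\wp B^\perp$, $(A\wp B)^\perp=A^\perp\otimes B^\perp$, $\mathbf1^\perp=\bot$, $\bot^\perp=\mathbf1$, $({!}A)^\perp={?}(A^\perp)$, $({?}A)^\perp={!}(A^\perp)$. Terms of $\lambda_{\mathrm{MELL}}$, over linear variables $a,b,c,\dots$ and unrestricted variables $u,v,\dots$: $t,s::=a\mid u\mid\langle t,s\rangle\mid t[\langle a,b\rangle:=s]\mid\wp(a,b).t\mid t\bullet s\mid t\blacktriangledown s\mid{!}a.t\mid t[{!}u:=s]\mid{?}u.t\mid t\blacktriangleright^{a}s\mid t\,\sharp\,s\mid\star\mid t[\star:=s]$. Binding: $t[\langle a,b\rangle:=s]$ and $\wp(a,b).t$ bind $a,b$ in $t$; ${!}a.t$ and $t\blacktriangleright^a s$ bind $a$ in $t$; $t[{!}u:=s]$ and ${?}u.t$ bind $u$ in $t$. Terms are taken up to $\alpha$-renaming, and bound variables are always chosen to avoid capture. Typing judgements $\Delta;\Gamma\vdash t:A$, where $\Delta$ (resp. $\Gamma$) is a finite partial function from unrestricted (resp. linear) variables to formulae; $\Gamma,\Gamma'$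 denotes union with disjoint domains. Typing rules: $\Rightarrow\Delta;a:A\vdash a:A$; $\Rightarrow\Delta,u:A;\cdot\vdash u:A$; $\Delta;\Gamma\vdash t:A$ and $\Delta;\Gamma'\vdash s:B$ $\Rightarrow$ $\Delta;\Gamma,\Gamma'\vdash\langle t,s\rangle:A\otimes B$; $\Delta;\Gamma\vdash s:A\otimes B$ and $\Delta;\Gamma',a:A,b:B\vdash t:C$ $\Rightarrow$ $\Delta;\Gamma,\Gamma'\vdash t[\langle a,b\rangle:=s]:C$; $\Delta;\Gamma,a:A,b:B\vdash t:\bot$ $\Rightarrow$ $\Delta;\Gamma\vdash\wp(a,b).t:A^\perp\wp B^\perp$; $\Delta;\Gamma\vdash t:A\wp B$ and $\Delta;\Gamma'\vdash s:A^\perp$ $\Rightarrow$ $\Delta;\Gamma,\Gamma'\vdash t\bullet s:B$; $\Delta;\Gamma\vdash t:A\wp B$ and $\Delta;\Gamma'\vdash s:B^\perp$ $\Rightarrow$ $\Delta;\Gamma,\Gamma'\vdash t\blacktriangledown s:A$; $\Delta;a:A\vdash t:\bot$ $\Rightarrow$ $\Delta;\cdot\vdash{!}a.t:{!}(A^\perp)$; $\Delta;\Gamma\vdash s:{!}A$ and $\Delta,u:A;\Gamma'\vdash t:B$ $\Rightarrow$ $\Delta;\Gamma,\Gamma'\vdash t[{!}u:=s]:B$; $\Delta,u:A^\perp;\Gamma\vdash t:\bot$ $\Rightarrow$ $\Delta;\Gamma\vdash{?}u.t:{?}A$; $\Delta;\Gamma\vdash s:{?}A$ and $\Delta;a:A\vdash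 t:\bot$ $\Rightarrow$ $\Delta;\Gamma\vdash t\blacktriangleright^a s:\bot$; $\Delta;\Gamma\vdash t:B$ and $\Delta;\Gamma'\vdash s:B^\perp$ $\Rightarrow$ $\Delta;\Gamma,\Gamma'\vdash t\,\sharp\,s:\bot$; $\Rightarrow\Delta;\cdot\vdash\star:\mathbf1$; $\Delta;\Gamma\vdash s:\mathbf1$ and $\Delta;\Gamma'\vdash t:A$ $\Rightarrow$ $\Delta;\Gamma,\Gamma'\vdash t[\star:=s]:A$. A term is linear if: each free linear variable occurs exactly once; each bound linear variable occurs exactly once in the scope of its binder; subterms ${!}a.t$ have no free linear variables; in subterms $t\blacktriangleright^a s$ only $a$ occurs as a free linear variable in $t$. $t\{a:=s\}$, $t\{u:=s\}$ denote capture-avoiding substitution. For a linear term $t$ with $a\in\mathrm{fv}(t)$, the contra-substitution $t\{a\backslash\!\backslash s\}$ is defined by induction on $t$ (case "$i$" applies when $a\in\mathrm{fv}(t_i)$): $a\{a\backslash\!\backslash s\}=s$; $\langle t_1,t_2\rangle\{a\backslash\!\backslash s\}=t_1\{a\backslash\!\backslash s\blacktriangledown t_2\}$ (case 1), $t_2\{a\backslash\!\backslash s\bullet t_1\}$ (case 2); $(t_1\bullet t_2)\{a\backslash\!\backslash s\}=t_1\{a\backslash\!\backslash\langle t_2,s\rangle\}$ (1), $t_2\{a\backslash\!\backslash t_1\blacktriangledown s\}$ (2); $(t_1\blacktriangledown t_2)\{a\backslash\!\backslash s\}=t_1\{a\backslash\!\backslash\langle s,t_2\rangle\}$ (1), $t_2\{a\backslash\!\backslash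 t_1\bullet s\}$ (2); $(t_1[\langle b,c\rangle:=t_2])\{a\backslash\!\backslash s\}=(t_1\{a\backslash\!\backslash s\})[\langle b,c\rangle:=t_2]$ (1, $a\notin\{b,c\}$), $t_2\{a\backslash\!\backslash\wp(b,c).(t_1\sharp s)\}$ (2); $(\wp(b,c).t)\{a\backslash\!\backslash s\}=(t\{a\backslash\!\backslash\star\})[\langle b,c\rangle:=s]$; $(t_1[{!}u:=t_2])\{a\backslash\!\backslash s\}=(t_1\{a\backslash\!\backslash s\})[{!}u:=t_2]$ (1), $t_2\{a\backslash\!\backslash{?}u.(t_1\sharp s)\}$ (2); $({?}u.t)\{a\backslash\!\backslash s\}=(t\{a\backslash\!\backslash\star\})[{!}u:=s]$; $(t_1\blacktriangleright^b t_2)\{a\backslash\!\backslash s\}=(t_2\{a\backslash\!\backslash{!}b.t_1\})[\star:=s]$ (only case 2 is possible); $(t_1\sharp t_2)\{a\backslash\!\backslash s\}=(t_1\{a\backslash\!\backslash t_2\})[\star:=s]$ (1), $(t_2\{a\backslash\!\backslash t_1\})[\star:=s]$ (2); $(t_1[\star:=t_2])\{a\backslash\!\backslash s\}=(t_1\{a\backslash\!\backslash s\})[\star:=t_2]$ (1), $t_2\{a\backslash\!\backslash t_1\sharp s\}$ (2). (Terms ${!}b.t$ and $\star$ have no free linear variables, so no clause is needed.) Positive elimination contexts: $L,K::=\Box\mid L[\langle a,b\rangle:=t]\mid L[{!}u:=t]\mid L[\star:=t]$; $tL$ denotes filling the hole of $L$ with $t$ (free variables of $t$ may be captured by $L$).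 Pre-reduction $\to^-$ is the contextual closure (under all term constructors) of the following axioms, where both sides are assumed typed with the same type in the same contexts: $(\wp(a,b).t)L\bullet r\mapsto t\{a:=r\}\{b\backslash\!\backslash\star\}L$ ($b\notin\mathrm{fv}(r)$); $(\wp(a,b).t)L\blacktriangledown r\mapsto t\{b:=r\}\{a\backslash\!\backslash\star\}L$ ($a\notin\mathrm{fv}(r)$); $t[\langle a,b\rangle:=\langle s,r\rangle L]\mapsto t\{a:=s\}\{b:=r\}L$ ($b\notin\mathrm{fv}(s)$); $t[{!}u:=({!}a.s)L]\mapsto t\{u:=s\{a\backslash\!\backslash\star\}\}L$; $t\blacktriangleright^a({?}u.s)L\mapsto s\{u:=t\{a\backslash\!\backslash\star\}\}L$; $(\wp(a,b).t)L\,\sharp\,\langle s,r\rangle K\mapsto t\{a:=s\}\{b:=r\}LK$ ($b\notin\mathrm{fv}(s)$); $\langle s,r\rangle L\,\sharp\,(\wp(a,b).t)K\mapsto t\{a:=s\}\{b:=r\}LK$ ($b\notin\mathrm{fv}(s)$); $({!}a.t)L\,\sharp\,({?}u.r)K\mapsto r\{u:=t\{a\backslash\!\backslash\star\}\}LK$; $({?}u.r)L\,\sharp\,({!}a.t)K\mapsto r\{u:=t\{a\backslash\!\backslash\star\}\}LK$. Positive eliminators $[\langle a,b\rangle:=t]$, $[{!}u:=t]$, $[\star:=t]$ are written $[p:=t]$, with $\mathrm{fv}(\langle a,b\rangle)=\{a,b\}$, $\mathrm{fv}({!}u)=\{u\}$, $\mathrm{fv}(\star)=\emptyset$. Surface contexts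 $S$ are: $\wp(a,b).\Box$, $\langle\Box,t\rangle$, $\langle t,\Box\rangle$, $\Box\bullet t$, $t\bullet\Box$, $\Box\blacktriangledown t$, $t\blacktriangledown\Box$, $\Box\,\sharp\,t$, $t\,\sharp\,\Box$, ${?}u.\Box$, $\Box[p:=t]$, $t[p:=\Box]$, $t\blacktriangleright^a\Box$. A term $r$ is free for $S$ if $S\langle r\rangle$ does not bind free variables of $r$. Structural equivalence $\equiv$ is the reflexive, symmetric, transitive and contextual closure of the following axioms, where both sides are assumed typed with the same type in the same contexts: $S\langle t\rangle[p:=r]\equiv S\langle t[p:=r]\rangle$ if $\mathrm{fv}(p)\cap\mathrm{fv}(S)=\emptyset$ and $r$ is free for $S$; $t[\star:=\star]\equiv t$; $t[\star:=s]\equiv s[\star:=t]$; $t\{a\backslash\!\backslash\star\}\,\sharp\,r\equiv t\{a:=r\}$. $\lambda_{\mathrm{MELL}}$-reduction: $t\to s$ iff there exist $t',s'$ with $t\equiv t'\to^-s'\equiv s$. Reduction is considered modulo $\equiv$; $\twoheadrightarrow$ is the reflexive-transitive closure of $\to\cup\equiv$. T-translation. Write ${!}t:={!}a.(t\,\sharp\,a)$ with $a$ fresh. On types: $\alpha^{\mathsf T}=\alpha$, $(A\supset B)^{\mathsf T}={?}{!}(A^{\mathsf T})^\perp\wp{?}B^{\mathsf T}$. Variables and co-variables are regarded as unrestricted variables; in the translated judgement a variable $x:B$ gets type ${?}B^{\mathsf T}$, a co-variable $\gamma:B$ gets type $(B^{\mathsf T})^\perp$ (linear environment empty), commands get type $\bot$,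 co-terms of type $A$ get type ${!}((A^{\mathsf T})^\perp)$, terms of type $A$ get type ${?}A^{\mathsf T}$. On expressions (with $u$ unrestricted and $a,b$ linear, fresh): $x^{\mathsf T}=x$; $(\mu\gamma.c)^{\mathsf T}={?}\gamma.c^{\mathsf T}$; $(\lambda x.v)^{\mathsf T}={?}u.(u\,\sharp\,\wp(a,b).((v^{\mathsf T}\,\sharp\,b)[{!}x:=a]))$; $\gamma^{\mathsf T}={!}\gamma$; $(v\cdot e)^{\mathsf T}={!}\langle{!}v^{\mathsf T},e^{\mathsf T}\rangle$; $\langle v\mid e\rangle^{\mathsf T}=v^{\mathsf T}\,\sharp\,e^{\mathsf T}$. -}

module Defs where

open import Data.Fin using (Fin; zero; suc; lift; punchIn; splitAt; _↑ˡ_; _↑ʳ_)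
open import Data.List using (List; []; _∷_)
open import Data.Maybe using (Maybe; just; nothing)
open import Data.Nat using (ℕ; suc; _+_)
open import Data.Product using (_×_; ∃₂)
open import Data.Sum using ([_,_])
open import Data.Vec using (Vec; []; _∷_; lookup; map; replicate; _[_]≔_) renaming (_++_ to _++ᵛ_)
open import Data.Vec.Functional using (insertAt; _++_)
open import Function using (_∘_; id)
open import Relation.Binary.Construct.Closure.Equivalence using (EqClosure)
open import Relation.Binary.Construct.Closure.ReflexiveTransitive using (Star)
open import Relation.Binary.Construct.Union using (_∪_)

Atom : Set
Atom = ℕ

variable
  a b k l m n m′ n′ : ℕ

------------------------------------------------------------------------
-- λ̄μμ̃-expressions are well-scoped de Bruijn terms: in Term n k, n counts the
-- variables and k the co-variables in scope.

infixr 6 _⊃_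
data Type : Set where
  atom : Atom → Type
  _⊃_  : Type → Type → Type

variable
  S T : Type

infixr 7 _·_
data Term   (n k : ℕ) : Set
data CoTerm (n k : ℕ) : Set
data Cmd    (n k : ℕ) : Set

data Term n k where
  var : Fin n → Term n k
  μ   : Cmd n (suc k) → Term n k
  ƛ   : Term (suc n) k → Term n k

data CoTerm n k where
  covar : Fin k → CoTerm n k
  _·_   : Term n k → CoTerm n k → CoTerm n k

data Cmd n k where
  ⟨_∣_⟩ : Term n k → CoTerm n k → Cmd n k

renᵛ : (Fin n → Fin n′) → (Fin k → Fin l) → Term n k → Term n′ l
renᵉ : (Fin n → Fin n′) → (Fin k → Fin l) → CoTerm n k → CoTerm n′ l
renᶜ : (Fin n → Fin n′) → (Fin k → Fin l) → Cmd n k → Cmd n′ l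

renᵛ ρ κ (var x)     = var (ρ x)
renᵛ ρ κ (μ c)       = μ (renᶜ ρ (lift 1 κ) c)
renᵛ ρ κ (ƛ v)       = ƛ (renᵛ (lift 1 ρ) κ v)
renᵉ ρ κ (covar γ)   = covar (κ γ)
renᵉ ρ κ (v · e)     = renᵛ ρ κ v · renᵉ ρ κ e
renᶜ ρ κ ⟨ v ∣ e ⟩   = ⟨ renᵛ ρ κ v ∣ renᵉ ρ κ e ⟩

subᵛ : (Fin n → Term n′ l) → (Fin k → CoTerm n′ l) → Term n k → Term n′ l
subᵉ : (Fin n → Term n′ l) → (Fin k → CoTerm n′ l) → CoTerm n k → CoTerm n′ l
subᶜ : (Fin n → Term n′ l) → (Fin k → CoTerm n′ l) → Cmd n k → Cmd n′ l

subᵛ σ τ (var x)     = σ x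
subᵛ σ τ (μ c)       = μ (subᶜ (renᵛ id suc ∘ σ)
                               (insertAt (renᵉ id suc ∘ τ) zero (covar zero)) c)
subᵛ σ τ (ƛ v)       = ƛ (subᵛ (insertAt (renᵛ suc id ∘ σ) zero (var zero))
                               (renᵉ suc id ∘ τ) v)
subᵉ σ τ (covar γ)   = τ γ
subᵉ σ τ (v · e)     = subᵛ σ τ v · subᵉ σ τ e
subᶜ σ τ ⟨ v ∣ e ⟩   = ⟨ subᵛ σ τ v ∣ subᵉ σ τ e ⟩

infixl 8 _[x:=_] _[γ:=_]
_[x:=_] : Term (suc n) k → Term n k → Term n k
v [x:= v′ ] = subᵛ (insertAt var zero v′) covar v

_[γ:=_] : Cmd n (suc k) → CoTerm n k → Cmd n k
c [γ:= e ] = subᶜ var (insertAt covar zero e) c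

infix 4 _⊢_∶_∣_ _∣_∶_⊢_ _∶[_⊢_]
data _⊢_∶_∣_ (Γ : Vec Type n) : Term n k → Type → Vec Type k → Set
data _∣_∶_⊢_ (Γ : Vec Type n) : CoTerm n k → Type → Vec Type k → Set
data _∶[_⊢_] : Cmd n k → Vec Type n → Vec Type k → Set

data _⊢_∶_∣_ {n} Γ where
  var : {Θ : Vec Type k} (x : Fin n) → Γ ⊢ var x ∶ lookup Γ x ∣ Θ
  μ   : {Θ : Vec Type k} {c : Cmd n (suc k)} →
        c ∶[ Γ ⊢ T ∷ Θ ] → Γ ⊢ μ c ∶ T ∣ Θ
  ƛ   : {Θ : Vec Type k} {v : Term (suc n) k} →
        S ∷ Γ ⊢ v ∶ T ∣ Θ → Γ ⊢ ƛ v ∶ S ⊃ T ∣ Θ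

data _∣_∶_⊢_ {n} Γ where
  covar : {Θ : Vec Type k} (γ : Fin k) → Γ ∣ covar γ ∶ lookup Θ γ ⊢ Θ
  _·_   : {Θ : Vec Type k} {v : Term n k} {e : CoTerm n k} →
          Γ ⊢ v ∶ S ∣ Θ → Γ ∣ e ∶ T ⊢ Θ → Γ ∣ v · e ∶ S ⊃ T ⊢ Θ

data _∶[_⊢_] where
  ⟨_∣_⟩ : {Γ : Vec Type n} {Θ : Vec Type k} {v : Term n k} {e : CoTerm n k} →
          Γ ⊢ v ∶ T ∣ Θ → Γ ∣ e ∶ T ⊢ Θ → ⟨ v ∣ e ⟩ ∶[ Γ ⊢ Θ ]

infix 4 _⟶ᵛ_ _⟶ᵉ_ _⟶ᶜ_
data _⟶ᵛ_ : Term n k → Term n k → Set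
data _⟶ᵉ_ : CoTerm n k → CoTerm n k → Set
data _⟶ᶜ_ : Cmd n k → Cmd n k → Set

data _⟶ᵛ_ where
  μ : {c c′ : Cmd n (suc k)} → c ⟶ᶜ c′ → μ c ⟶ᵛ μ c′
  ƛ : {v v′ : Term (suc n) k} → v ⟶ᵛ v′ → ƛ v ⟶ᵛ ƛ v′

data _⟶ᵉ_ where
  ·ˡ : {v v′ : Term n k} {e : CoTerm n k} → v ⟶ᵛ v′ → v · e ⟶ᵉ v′ · e
  ·ʳ : {v : Term n k} {e e′ : CoTerm n k} → e ⟶ᵉ e′ → v · e ⟶ᵉ v · e′

data _⟶ᶜ_ where
  β  : {v₁ : Term (suc n) k} {v₂ : Term n k} {e : CoTerm n k} →
       ⟨ ƛ v₁ ∣ v₂ · e ⟩ ⟶ᶜ ⟨ v₁ [x:= v₂ ] ∣ e ⟩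
  μ  : {c : Cmd n (suc k)} {e : CoTerm n k} → ⟨ μ c ∣ e ⟩ ⟶ᶜ c [γ:= e ]
  ⟨⟩ˡ : {v v′ : Term n k} {e : CoTerm n k} → v ⟶ᵛ v′ → ⟨ v ∣ e ⟩ ⟶ᶜ ⟨ v′ ∣ e ⟩
  ⟨⟩ʳ : {v : Term n k} {e e′ : CoTerm n k} → e ⟶ᵉ e′ → ⟨ v ∣ e ⟩ ⟶ᶜ ⟨ v ∣ e′ ⟩

------------------------------------------------------------------------

infixr 6 _⊗_ _⅋_
infix  7 !_ ¿_
data Form : Set where
  pos neg : Atom → Form
  _⊗_ _⅋_ : Form → Form → Form
  𝟏 ⊥     : Form
  !_ ¿_   : Form → Form

infixl 8 _^⊥
_^⊥ : Form → Form
pos α   ^⊥ = neg α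
neg α   ^⊥ = pos α
(A ⊗ B) ^⊥ = A ^⊥ ⅋ B ^⊥
(A ⅋ B) ^⊥ = A ^⊥ ⊗ B ^⊥
𝟏       ^⊥ = ⊥
⊥       ^⊥ = 𝟏
(! A)   ^⊥ = ¿ (A ^⊥)
(¿ A)   ^⊥ = ! (A ^⊥)

variable
  A B C : Form

------------------------------------------------------------------------
-- λ_MELL-terms are well-scoped de Bruijn terms: in Tm m n, m counts the
-- unrestricted and n the linear variables in scope.  Where a pair (a , b) of
-- linear variables is bound, a is index 0 and b is index 1.

-- A pattern in Pat a b binds a unrestricted and b linear variables.
data Pat : ℕ → ℕ → Set where
  ⊗ᵖ : Pat 0 2
  !ᵖ : Pat 1 0
  ⋆ᵖ : Pat 0 0

infixl 8 _[_:=_]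
infixl 7 _•_ _▼_ _▶_
infix  6 _♯_
infixr 9 ⅋·_ !·_ ¿·_
data Tm (m n : ℕ) : Set where
  lvar    : Fin n → Tm m n
  uvar    : Fin m → Tm m n
  ⟨_,_⟩   : Tm m n → Tm m n → Tm m n
  _[_:=_] : Tm (a + m) (b + n) → Pat a b → Tm m n → Tm m n
  ⅋·_     : Tm m (2 + n) → Tm m n
  _•_ _▼_ : Tm m n → Tm m n → Tm m n
  !·_     : Tm m (1 + n) → Tm m n
  ¿·_     : Tm (1 + m) n → Tm m n
  _▶_     : Tm m (1 + n) → Tm m n → Tm m n
  _♯_     : Tm m n → Tm m n → Tm m n
  ⋆       : Tm m n

ren : (Fin m → Fin m′) → (Fin n → Fin n′) → Tm m n → Tm m′ n′
ren ρ θ (lvar i)                      = lvar (θ i)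
ren ρ θ (uvar i)                      = uvar (ρ i)
ren ρ θ ⟨ t , s ⟩                     = ⟨ ren ρ θ t , ren ρ θ s ⟩
ren ρ θ (_[_:=_] {a = a} {b = b} t p s) = ren (lift a ρ) (lift b θ) t [ p := ren ρ θ s ]
ren ρ θ (⅋· t)                        = ⅋· ren ρ (lift 2 θ) t
ren ρ θ (t • s)                       = ren ρ θ t • ren ρ θ s
ren ρ θ (t ▼ s)                       = ren ρ θ t ▼ ren ρ θ s
ren ρ θ (!· t)                        = !· ren ρ (lift 1 θ) t
ren ρ θ (¿· t)                        = ¿· ren (lift 1 ρ) θ t
ren ρ θ (t ▶ s)                       = ren ρ (lift 1 θ) t ▶ ren ρ θ s
ren ρ θ (t ♯ s)                       = ren ρ θ t ♯ ren ρ θ s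
ren ρ θ ⋆                             = ⋆

-- Weakening by a block of a unrestricted and b linear innermost binders.
wk : ∀ a b → Tm m n → Tm (a + m) (b + n)
wk a b = ren (a ↑ʳ_) (b ↑ʳ_)

-- Weakening by one linear variable, which gets index i.
wkₗ : Fin (suc n) → Tm m n → Tm m (suc n)
wkₗ i = ren id (punchIn i)

liftᵤ : ∀ a b → (Fin m → Tm m′ n′) → Fin (a + m) → Tm (a + m′) (b + n′)
liftᵤ {m′ = m′} a b σ = (uvar ∘ (_↑ˡ m′)) ++ (wk a b ∘ σ)

liftₗ : ∀ a b → (Fin n → Tm m′ n′) → Fin (b + n) → Tm (a + m′) (b + n′)
liftₗ {n′ = n′} a b τ = (lvar ∘ (_↑ˡ n′)) ++ (wk a b ∘ τ)

sub : (Fin m → Tm m′ n′) → (Fin n → Tm m′ n′) → Tm m n → Tm m′ n′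
sub σ τ (lvar i)                      = τ i
sub σ τ (uvar i)                      = σ i
sub σ τ ⟨ t , s ⟩                     = ⟨ sub σ τ t , sub σ τ s ⟩
sub σ τ (_[_:=_] {a = a} {b = b} t p s) = sub (liftᵤ a b σ) (liftₗ a b τ) t [ p := sub σ τ s ]
sub σ τ (⅋· t)                        = ⅋· sub (liftᵤ 0 2 σ) (liftₗ 0 2 τ) t
sub σ τ (t • s)                       = sub σ τ t • sub σ τ s
sub σ τ (t ▼ s)                       = sub σ τ t ▼ sub σ τ s
sub σ τ (!· t)                        = !· sub (liftᵤ 0 1 σ) (liftₗ 0 1 τ) t
sub σ τ (¿· t)                        = ¿· sub (liftᵤ 1 0 σ) (liftₗ 1 0 τ) t
sub σ τ (t ▶ s)                       = sub (liftᵤ 0 1 σ) (liftₗ 0 1 τ) t ▶ sub σ τ s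
sub σ τ (t ♯ s)                       = sub σ τ t ♯ sub σ τ s
sub σ τ ⋆                             = ⋆

infixl 8 _⟪_:=ₗ_⟫ _⟪_:=ᵤ_⟫
_⟪_:=ₗ_⟫ : Tm m (suc n) → Fin (suc n) → Tm m n → Tm m n
t ⟪ i :=ₗ s ⟫ = sub uvar (insertAt lvar i s) t

_⟪_:=ᵤ_⟫ : Tm (suc m) n → Fin (suc m) → Tm m n → Tm m n
t ⟪ i :=ᵤ s ⟫ = sub (insertAt uvar i s) lvar t

-- The graph of the (partial) contra-substitution t{a\\s}.  A derivation
-- exists only if i occurs in t, in a position allowed for linear terms, and
-- the siblings along the path to it are weakenings, i.e. do not mention i.
infix 4 _⟪_\\_⟫↝_
data _⟪_\\_⟫↝_ {m n} : Tm m (suc n) → Fin (suc n) → Tm m n → Tm m n → Set where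
  \\var : ∀ {i s} →
    lvar i ⟪ i \\ s ⟫↝ s
  \\pair₁ : ∀ {t₁ t₂ i s r} →
    t₁ ⟪ i \\ s ▼ t₂ ⟫↝ r →
    ⟨ t₁ , wkₗ i t₂ ⟩ ⟪ i \\ s ⟫↝ r
  \\pair₂ : ∀ {t₁ t₂ i s r} →
    t₂ ⟪ i \\ s • t₁ ⟫↝ r →
    ⟨ wkₗ i t₁ , t₂ ⟩ ⟪ i \\ s ⟫↝ r
  \\•₁ : ∀ {t₁ t₂ i s r} →
    t₁ ⟪ i \\ ⟨ t₂ , s ⟩ ⟫↝ r →
    t₁ • wkₗ i t₂ ⟪ i \\ s ⟫↝ r
  \\•₂ : ∀ {t₁ t₂ i s r} →
    t₂ ⟪ i \\ t₁ ▼ s ⟫↝ r →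
    wkₗ i t₁ • t₂ ⟪ i \\ s ⟫↝ r
  \\▼₁ : ∀ {t₁ t₂ i s r} →
    t₁ ⟪ i \\ ⟨ s , t₂ ⟩ ⟫↝ r →
    t₁ ▼ wkₗ i t₂ ⟪ i \\ s ⟫↝ r
  \\▼₂ : ∀ {t₁ t₂ i s r} →
    t₂ ⟪ i \\ t₁ • s ⟫↝ r →
    wkₗ i t₁ ▼ t₂ ⟪ i \\ s ⟫↝ r
  \\⊗ᵖ₁ : ∀ {t₁ t₂ i s r} →
    t₁ ⟪ 2 ↑ʳ i \\ wk 0 2 s ⟫↝ r →
    t₁ [ ⊗ᵖ := wkₗ i t₂ ] ⟪ i \\ s ⟫↝ r [ ⊗ᵖ := t₂ ]
  \\⊗ᵖ₂ : ∀ {t₁ t₂ i s r} →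
    t₂ ⟪ i \\ ⅋· (t₁ ♯ wk 0 2 s) ⟫↝ r →
    wkₗ (2 ↑ʳ i) t₁ [ ⊗ᵖ := t₂ ] ⟪ i \\ s ⟫↝ r
  \\⅋ : ∀ {t i s r} →
    t ⟪ 2 ↑ʳ i \\ ⋆ ⟫↝ r →
    ⅋· t ⟪ i \\ s ⟫↝ r [ ⊗ᵖ := s ]
  \\!ᵖ₁ : ∀ {t₁ t₂ i s r} →
    t₁ ⟪ i \\ wk 1 0 s ⟫↝ r →
    t₁ [ !ᵖ := wkₗ i t₂ ] ⟪ i \\ s ⟫↝ r [ !ᵖ := t₂ ]
  \\!ᵖ₂ : ∀ {t₁ t₂ i s r} →
    t₂ ⟪ i \\ ¿· (t₁ ♯ wk 1 0 s) ⟫↝ r →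
    wkₗ i t₁ [ !ᵖ := t₂ ] ⟪ i \\ s ⟫↝ r
  \\¿ : ∀ {t i s r} →
    t ⟪ i \\ ⋆ ⟫↝ r →
    ¿· t ⟪ i \\ s ⟫↝ r [ !ᵖ := s ]
  \\▶₂ : ∀ {t₁ t₂ i s r} →
    t₂ ⟪ i \\ !· t₁ ⟫↝ r →
    wkₗ (1 ↑ʳ i) t₁ ▶ t₂ ⟪ i \\ s ⟫↝ r [ ⋆ᵖ := s ]
  \\♯₁ : ∀ {t₁ t₂ i s r} →
    t₁ ⟪ i \\ t₂ ⟫↝ r →
    t₁ ♯ wkₗ i t₂ ⟪ i \\ s ⟫↝ r [ ⋆ᵖ := s ]
  \\♯₂ : ∀ {t₁ t₂ i s r} →
    t₂ ⟪ i \\ t₁ ⟫↝ r →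
    wkₗ i t₁ ♯ t₂ ⟪ i \\ s ⟫↝ r [ ⋆ᵖ := s ]
  \\⋆ᵖ₁ : ∀ {t₁ t₂ i s r} →
    t₁ ⟪ i \\ s ⟫↝ r →
    t₁ [ ⋆ᵖ := wkₗ i t₂ ] ⟪ i \\ s ⟫↝ r [ ⋆ᵖ := t₂ ]
  \\⋆ᵖ₂ : ∀ {t₁ t₂ i s r} →
    t₂ ⟪ i \\ t₁ ♯ s ⟫↝ r →
    wkₗ i t₁ [ ⋆ᵖ := t₂ ] ⟪ i \\ s ⟫↝ r

------------------------------------------------------------------------
-- A linear environment is a partial function on the linear variables
-- in scope; an unrestricted one is total on the unrestricted variables in
-- scope, its domain being the scope itself.

UEnv LEnv : ℕ → Set
UEnv = Vec Form
LEnv = Vec (Maybe Form)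

∅ : LEnv n
∅ = replicate _ nothing

infix 4 _≔_⊎_
data _≔_⊎_ : LEnv n → LEnv n → LEnv n → Set where
  []   : [] ≔ [] ⊎ []
  none : {Γ Γ₁ Γ₂ : LEnv n} → Γ ≔ Γ₁ ⊎ Γ₂ → nothing ∷ Γ ≔ nothing ∷ Γ₁ ⊎ nothing ∷ Γ₂
  inˡ  : {Γ Γ₁ Γ₂ : LEnv n} → Γ ≔ Γ₁ ⊎ Γ₂ → just A ∷ Γ ≔ just A ∷ Γ₁ ⊎ nothing ∷ Γ₂
  inʳ  : {Γ Γ₁ Γ₂ : LEnv n} → Γ ≔ Γ₁ ⊎ Γ₂ → just A ∷ Γ ≔ nothing ∷ Γ₁ ⊎ just A ∷ Γ₂

variable
  Δ : UEnv m
  Γ Γ₁ Γ₂ : LEnv n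
  t t′ s s′ r : Tm m n

infix 4 _⨾_⊢_∶_
data _⨾_⊢_∶_ {m n} (Δ : UEnv m) : LEnv n → Tm m n → Form → Set where
  ⊢lvar : ∀ i → Δ ⨾ ∅ [ i ]≔ just A ⊢ lvar i ∶ A
  ⊢uvar : ∀ i → Δ ⨾ ∅ ⊢ uvar i ∶ lookup Δ i
  ⊢pair : Γ ≔ Γ₁ ⊎ Γ₂ → Δ ⨾ Γ₁ ⊢ t ∶ A → Δ ⨾ Γ₂ ⊢ s ∶ B →
          Δ ⨾ Γ ⊢ ⟨ t , s ⟩ ∶ A ⊗ B
  ⊢⊗ᵖ   : Γ ≔ Γ₁ ⊎ Γ₂ → Δ ⨾ Γ₁ ⊢ s ∶ A ⊗ B → Δ ⨾ just A ∷ just B ∷ Γ₂ ⊢ t ∶ C →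
          Δ ⨾ Γ ⊢ t [ ⊗ᵖ := s ] ∶ C
  ⊢⅋    : Δ ⨾ just A ∷ just B ∷ Γ ⊢ t ∶ ⊥ → Δ ⨾ Γ ⊢ ⅋· t ∶ A ^⊥ ⅋ B ^⊥
  ⊢•    : Γ ≔ Γ₁ ⊎ Γ₂ → Δ ⨾ Γ₁ ⊢ t ∶ A ⅋ B → Δ ⨾ Γ₂ ⊢ s ∶ A ^⊥ →
          Δ ⨾ Γ ⊢ t • s ∶ B
  ⊢▼    : Γ ≔ Γ₁ ⊎ Γ₂ → Δ ⨾ Γ₁ ⊢ t ∶ A ⅋ B → Δ ⨾ Γ₂ ⊢ s ∶ B ^⊥ →
          Δ ⨾ Γ ⊢ t ▼ s ∶ A
  ⊢!    : Δ ⨾ just A ∷ ∅ ⊢ t ∶ ⊥ → Δ ⨾ ∅ ⊢ !· t ∶ ! (A ^⊥)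
  ⊢!ᵖ   : Γ ≔ Γ₁ ⊎ Γ₂ → Δ ⨾ Γ₁ ⊢ s ∶ ! A → A ∷ Δ ⨾ Γ₂ ⊢ t ∶ B →
          Δ ⨾ Γ ⊢ t [ !ᵖ := s ] ∶ B
  ⊢¿    : A ^⊥ ∷ Δ ⨾ Γ ⊢ t ∶ ⊥ → Δ ⨾ Γ ⊢ ¿· t ∶ ¿ A
  ⊢▶    : Δ ⨾ Γ ⊢ s ∶ ¿ A → Δ ⨾ just A ∷ ∅ ⊢ t ∶ ⊥ → Δ ⨾ Γ ⊢ t ▶ s ∶ ⊥
  ⊢♯    : Γ ≔ Γ₁ ⊎ Γ₂ → Δ ⨾ Γ₁ ⊢ t ∶ B → Δ ⨾ Γ₂ ⊢ s ∶ B ^⊥ →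
          Δ ⨾ Γ ⊢ t ♯ s ∶ ⊥
  ⊢⋆    : Δ ⨾ ∅ ⊢ ⋆ ∶ 𝟏
  ⊢⋆ᵖ   : Γ ≔ Γ₁ ⊎ Γ₂ → Δ ⨾ Γ₁ ⊢ s ∶ 𝟏 → Δ ⨾ Γ₂ ⊢ t ∶ A →
          Δ ⨾ Γ ⊢ t [ ⋆ᵖ := s ] ∶ A

------------------------------------------------------------------------
-- The hole of L : LCtx m n us ls is in scope
-- of ext us m unrestricted and ext ls n linear variables.

ext : List ℕ → ℕ → ℕ
ext []       n = n
ext (k ∷ ks) n = ext ks (k + n)

wk* : ∀ ks → Fin n → Fin (ext ks n)
wk* []       i = i
wk* (k ∷ ks) i = wk* ks (k ↑ʳ i)

lift* : ∀ ks → (Fin n → Fin n′) → Fin (ext ks n) → Fin (ext ks n′)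
lift* []       ρ = ρ
lift* (k ∷ ks) ρ = lift* ks (lift k ρ)

variable
  us us′ ls ls′ : List ℕ

data LCtx (m n : ℕ) : List ℕ → List ℕ → Set where
  □       : LCtx m n [] []
  _[_:=_] : LCtx (a + m) (b + n) us ls → Pat a b → Tm m n → LCtx m n (a ∷ us) (b ∷ ls)

-- t ◂ L is tL: the hole is filled with capture.
infixl 5 _◂_
_◂_ : Tm (ext us m) (ext ls n) → LCtx m n us ls → Tm m n
t ◂ □              = t
t ◂ (L [ p := s ]) = (t ◂ L) [ p := s ]

renL : (Fin m → Fin m′) → (Fin n → Fin n′) → LCtx m n us ls → LCtx m′ n′ us ls
renL ρ θ □              = □
renL ρ θ (_[_:=_] {a = a} {b = b} L p s) = renL (lift a ρ) (lift b θ) L [ p := ren ρ θ s ]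

infixl 6 _↓_
_↓_ : LCtx m n us ls → (K : LCtx m n us′ ls′) → LCtx (ext us′ m) (ext ls′ n) us ls
_↓_ {us′ = us} {ls′ = ls} L K = renL (wk* us) (wk* ls) L

-- Moving a term, itself below a + b binders, from outside L to the hole of L.
into : ∀ a b → LCtx m n us ls → Tm (a + m) (b + n) → Tm (a + ext us m) (b + ext ls n)
into {us = us} {ls = ls} a b L = ren (lift a (wk* us)) (lift b (wk* ls))

-- Moving a term, itself below a + b binders, from the hole of L to the hole of
-- L ↓ K.
across : ∀ a b (L : LCtx m n us ls) (K : LCtx m n us′ ls′) →
         Tm (a + ext us m) (b + ext ls n) →
         Tm (a + ext us (ext us′ m)) (b + ext ls (ext ls′ n))
across {us = us} {ls = ls} {us′ = us′} {ls′ = ls′} a b L K =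
  ren (lift a (lift* us (wk* us′))) (lift b (lift* ls (wk* ls′)))

------------------------------------------------------------------------
-- The side conditions on bound variables hold because r, s are explicitly
-- weakened before being substituted.

infix 4 _↦_
data _↦_ {m n} : Tm m n → Tm m n → Set where
  β⅋• : (L : LCtx m n us ls) →
        t ⟪ zero :=ₗ wkₗ zero (into 0 0 L r) ⟫ ⟪ zero \\ ⋆ ⟫↝ t′ →
        (⅋· t ◂ L) • r ↦ t′ ◂ L
  β⅋▼ : (L : LCtx m n us ls) →
        t ⟪ suc zero :=ₗ wkₗ zero (into 0 0 L r) ⟫ ⟪ zero \\ ⋆ ⟫↝ t′ →
        (⅋· t ◂ L) ▼ r ↦ t′ ◂ L
  β⊗  : (L : LCtx m n us ls) →
        t [ ⊗ᵖ := ⟨ s , r ⟩ ◂ L ] ↦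
        into 0 2 L t ⟪ zero :=ₗ wkₗ zero s ⟫ ⟪ zero :=ₗ r ⟫ ◂ L
  β!  : (L : LCtx m n us ls) →
        s ⟪ zero \\ ⋆ ⟫↝ s′ →
        t [ !ᵖ := !· s ◂ L ] ↦ into 1 0 L t ⟪ zero :=ᵤ s′ ⟫ ◂ L
  β¿  : (L : LCtx m n us ls) →
        t ⟪ zero \\ ⋆ ⟫↝ t′ →
        t ▶ (¿· s ◂ L) ↦ s ⟪ zero :=ᵤ into 0 0 L t′ ⟫ ◂ L
  β⅋♯⊗ : (L : LCtx m n us ls) (K : LCtx m n us′ ls′) →
        (⅋· t ◂ L) ♯ (⟨ s , r ⟩ ◂ K) ↦
        across 0 2 L K t ⟪ zero :=ₗ wkₗ zero (into 0 0 (L ↓ K) s) ⟫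
                         ⟪ zero :=ₗ into 0 0 (L ↓ K) r ⟫ ◂ L ↓ K ◂ K
  β⊗♯⅋ : (L : LCtx m n us ls) (K : LCtx m n us′ ls′) →
        (⟨ s , r ⟩ ◂ L) ♯ (⅋· t ◂ K) ↦
        into 0 2 (L ↓ K) t ⟪ zero :=ₗ wkₗ zero (across 0 0 L K s) ⟫
                           ⟪ zero :=ₗ across 0 0 L K r ⟫ ◂ L ↓ K ◂ K
  β!♯¿ : (L : LCtx m n us ls) (K : LCtx m n us′ ls′) →
        t ⟪ zero \\ ⋆ ⟫↝ t′ →
        (!· t ◂ L) ♯ (¿· r ◂ K) ↦
        into 1 0 (L ↓ K) r ⟪ zero :=ᵤ across 0 0 L K t′ ⟫ ◂ L ↓ K ◂ K
  β¿♯! : (L : LCtx m n us ls) (K : LCtx m n us′ ls′) →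
        t ⟪ zero \\ ⋆ ⟫↝ t′ →
        (¿· r ◂ L) ♯ (!· t ◂ K) ↦
        across 1 0 L K r ⟪ zero :=ᵤ into 0 0 (L ↓ K) t′ ⟫ ◂ L ↓ K ◂ K

------------------------------------------------------------------------

-- Surface contexts; those in Surface m n a b bind a unrestricted and b linear
-- variables in their hole.
data Surface (m n : ℕ) : ℕ → ℕ → Set where
  ⅋·□   : Surface m n 0 2
  ⟨□,_⟩ ⟨_,□⟩ □•_ _•□ □▼_ _▼□ □♯_ _♯□ : Tm m n → Surface m n 0 0
  ¿·□   : Surface m n 1 0
  □[_:=_] : Pat a b → Tm m n → Surface m n a b
  _[_:=□] : Tm (a + m) (b + n) → Pat a b → Surface m n 0 0
  _▶□   : Tm m (1 + n) → Surface m n 0 0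

plug : Surface m n a b → Tm (a + m) (b + n) → Tm m n
plug ⅋·□          t = ⅋· t
plug ⟨□, s ⟩      t = ⟨ t , s ⟩
plug ⟨ s ,□⟩      t = ⟨ s , t ⟩
plug (□• s)       t = t • s
plug (s •□)       t = s • t
plug (□▼ s)       t = t ▼ s
plug (s ▼□)       t = s ▼ t
plug (□♯ s)       t = t ♯ s
plug (s ♯□)       t = s ♯ t
plug ¿·□          t = ¿· t
plug □[ p := s ]  t = t [ p := s ]
plug (s [ p :=□]) t = s [ p := t ]
plug (s ▶□)       t = s ▶ t

renS : (Fin m → Fin m′) → (Fin n → Fin n′) → Surface m n a b → Surface m′ n′ a b
renS ρ θ ⅋·□          = ⅋·□
renS ρ θ ⟨□, s ⟩      = ⟨□, ren ρ θ s ⟩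
renS ρ θ ⟨ s ,□⟩      = ⟨ ren ρ θ s ,□⟩
renS ρ θ (□• s)       = □• ren ρ θ s
renS ρ θ (s •□)       = ren ρ θ s •□
renS ρ θ (□▼ s)       = □▼ ren ρ θ s
renS ρ θ (s ▼□)       = ren ρ θ s ▼□
renS ρ θ (□♯ s)       = □♯ ren ρ θ s
renS ρ θ (s ♯□)       = ren ρ θ s ♯□
renS ρ θ ¿·□          = ¿·□
renS ρ θ □[ p := s ]  = □[ p := ren ρ θ s ]
renS ρ θ (_[_:=□] {a = a} {b = b} s p) = ren (lift a ρ) (lift b θ) s [ p :=□]
renS ρ θ (s ▶□)       = ren ρ (lift 1 θ) s ▶□

-- Exchange of the two innermost blocks of binders.
swap : ∀ a b → Fin (a + (b + n)) → Fin (b + (a + n))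
swap {n = n} a b = [ (λ i → b ↑ʳ (i ↑ˡ n)) , [ (_↑ˡ (a + n)) , (λ i → b ↑ʳ (a ↑ʳ i)) ] ∘ splitAt b ]
                   ∘ splitAt a

-- In commute, fv(p) ∩ fv(S) = ∅ is expressed by weakening S, and r being free
-- for S by weakening r.
infix 4 _≅_
data _≅_ {m n} : Tm m n → Tm m n → Set where
  commute : ∀ {a b c d} (S : Surface m n a b) (p : Pat c d)
            (t : Tm (a + (c + m)) (b + (d + n))) (r : Tm m n) →
            plug (renS (c ↑ʳ_) (d ↑ʳ_) S) t [ p := r ] ≅
            plug S (ren (swap a c) (swap b d) t [ p := wk a b r ])
  ⋆-unit  : t [ ⋆ᵖ := ⋆ ] ≅ t
  ⋆-swap  : t [ ⋆ᵖ := s ] ≅ s [ ⋆ᵖ := t ]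
  contra  : ∀ i → t ⟪ i \\ ⋆ ⟫↝ t′ → t′ ♯ r ≅ t ⟪ i :=ₗ r ⟫

------------------------------------------------------------------------
-- The typed contextual closure of R: Closure R Δ Γ A t s relates terms of type
-- A under Δ and Γ, instances of R being restricted to those whose sides have
-- the same type in the same environments.

data Closure (R : ∀ {m n} → Tm m n → Tm m n → Set) {m n} (Δ : UEnv m) :
             LEnv n → Form → Tm m n → Tm m n → Set where
  axiom  : R t s → Δ ⨾ Γ ⊢ t ∶ A → Δ ⨾ Γ ⊢ s ∶ A → Closure R Δ Γ A t s
  ξpairˡ : Γ ≔ Γ₁ ⊎ Γ₂ → Closure R Δ Γ₁ A t t′ → Δ ⨾ Γ₂ ⊢ s ∶ B →
           Closure R Δ Γ (A ⊗ B) ⟨ t , s ⟩ ⟨ t′ , s ⟩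
  ξpairʳ : Γ ≔ Γ₁ ⊎ Γ₂ → Δ ⨾ Γ₁ ⊢ t ∶ A → Closure R Δ Γ₂ B s s′ →
           Closure R Δ Γ (A ⊗ B) ⟨ t , s ⟩ ⟨ t , s′ ⟩
  ξ⊗ᵖˡ   : Γ ≔ Γ₁ ⊎ Γ₂ → Δ ⨾ Γ₁ ⊢ s ∶ A ⊗ B →
           Closure R Δ (just A ∷ just B ∷ Γ₂) C t t′ →
           Closure R Δ Γ C (t [ ⊗ᵖ := s ]) (t′ [ ⊗ᵖ := s ])
  ξ⊗ᵖʳ   : Γ ≔ Γ₁ ⊎ Γ₂ → Closure R Δ Γ₁ (A ⊗ B) s s′ →
           Δ ⨾ just A ∷ just B ∷ Γ₂ ⊢ t ∶ C →
           Closure R Δ Γ C (t [ ⊗ᵖ := s ]) (t [ ⊗ᵖ := s′ ])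
  ξ⅋     : Closure R Δ (just A ∷ just B ∷ Γ) ⊥ t t′ →
           Closure R Δ Γ (A ^⊥ ⅋ B ^⊥) (⅋· t) (⅋· t′)
  ξ•ˡ    : Γ ≔ Γ₁ ⊎ Γ₂ → Closure R Δ Γ₁ (A ⅋ B) t t′ → Δ ⨾ Γ₂ ⊢ s ∶ A ^⊥ →
           Closure R Δ Γ B (t • s) (t′ • s)
  ξ•ʳ    : Γ ≔ Γ₁ ⊎ Γ₂ → Δ ⨾ Γ₁ ⊢ t ∶ A ⅋ B → Closure R Δ Γ₂ (A ^⊥) s s′ →
           Closure R Δ Γ B (t • s) (t • s′)
  ξ▼ˡ    : Γ ≔ Γ₁ ⊎ Γ₂ → Closure R Δ Γ₁ (A ⅋ B) t t′ → Δ ⨾ Γ₂ ⊢ s ∶ B ^⊥ →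
           Closure R Δ Γ A (t ▼ s) (t′ ▼ s)
  ξ▼ʳ    : Γ ≔ Γ₁ ⊎ Γ₂ → Δ ⨾ Γ₁ ⊢ t ∶ A ⅋ B → Closure R Δ Γ₂ (B ^⊥) s s′ →
           Closure R Δ Γ A (t ▼ s) (t ▼ s′)
  ξ!     : Closure R Δ (just A ∷ ∅) ⊥ t t′ → Closure R Δ ∅ (! (A ^⊥)) (!· t) (!· t′)
  ξ!ᵖˡ   : Γ ≔ Γ₁ ⊎ Γ₂ → Δ ⨾ Γ₁ ⊢ s ∶ ! A → Closure R (A ∷ Δ) Γ₂ B t t′ →
           Closure R Δ Γ B (t [ !ᵖ := s ]) (t′ [ !ᵖ := s ])
  ξ!ᵖʳ   : Γ ≔ Γ₁ ⊎ Γ₂ → Closure R Δ Γ₁ (! A) s s′ → A ∷ Δ ⨾ Γ₂ ⊢ t ∶ B →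
           Closure R Δ Γ B (t [ !ᵖ := s ]) (t [ !ᵖ := s′ ])
  ξ¿     : Closure R (A ^⊥ ∷ Δ) Γ ⊥ t t′ → Closure R Δ Γ (¿ A) (¿· t) (¿· t′)
  ξ▶ˡ    : Δ ⨾ Γ ⊢ s ∶ ¿ A → Closure R Δ (just A ∷ ∅) ⊥ t t′ →
           Closure R Δ Γ ⊥ (t ▶ s) (t′ ▶ s)
  ξ▶ʳ    : Closure R Δ Γ (¿ A) s s′ → Δ ⨾ just A ∷ ∅ ⊢ t ∶ ⊥ →
           Closure R Δ Γ ⊥ (t ▶ s) (t ▶ s′)
  ξ♯ˡ    : Γ ≔ Γ₁ ⊎ Γ₂ → Closure R Δ Γ₁ B t t′ → Δ ⨾ Γ₂ ⊢ s ∶ B ^⊥ →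
           Closure R Δ Γ ⊥ (t ♯ s) (t′ ♯ s)
  ξ♯ʳ    : Γ ≔ Γ₁ ⊎ Γ₂ → Δ ⨾ Γ₁ ⊢ t ∶ B → Closure R Δ Γ₂ (B ^⊥) s s′ →
           Closure R Δ Γ ⊥ (t ♯ s) (t ♯ s′)
  ξ⋆ᵖˡ   : Γ ≔ Γ₁ ⊎ Γ₂ → Δ ⨾ Γ₁ ⊢ s ∶ 𝟏 → Closure R Δ Γ₂ A t t′ →
           Closure R Δ Γ A (t [ ⋆ᵖ := s ]) (t′ [ ⋆ᵖ := s ])
  ξ⋆ᵖʳ   : Γ ≔ Γ₁ ⊎ Γ₂ → Closure R Δ Γ₁ 𝟏 s s′ → Δ ⨾ Γ₂ ⊢ t ∶ A →
           Closure R Δ Γ A (t [ ⋆ᵖ := s ]) (t [ ⋆ᵖ := s′ ])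

module _ (Δ : UEnv m) (Γ : LEnv n) (A : Form) where

  PreReduction Equivalence Reduction Reduction* : Tm m n → Tm m n → Set
  PreReduction  = Closure _↦_ Δ Γ A
  Equivalence   = EqClosure (Closure _≅_ Δ Γ A)
  Reduction t s = ∃₂ λ t′ s′ → Equivalence t t′ × PreReduction t′ s′ × Equivalence s′ s
  Reduction*    = Star (Reduction ∪ Equivalence)

infix 4 _⨾_⊢_↠_∶_
_⨾_⊢_↠_∶_ : UEnv m → LEnv n → Tm m n → Tm m n → Form → Set
Δ ⨾ Γ ⊢ t ↠ s ∶ A = Reduction* Δ Γ A t s

------------------------------------------------------------------------
-- ρ and κ say which unrestricted variables the variables and
-- co-variables in scope have become.

infixl 8 _ᵀ
_ᵀ : Type → Form
(atom α) ᵀ = pos α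
(S ⊃ T) ᵀ  = ¿ ! (S ᵀ ^⊥) ⅋ ¿ (T ᵀ)

bang : Tm m n → Tm m n
bang t = !· (wkₗ zero t ♯ lvar zero)

transᵛ : (Fin n → Fin m) → (Fin k → Fin m) → Term n k → Tm m l
transᵉ : (Fin n → Fin m) → (Fin k → Fin m) → CoTerm n k → Tm m l
transᶜ : (Fin n → Fin m) → (Fin k → Fin m) → Cmd n k → Tm m l

transᵛ ρ κ (var x)   = uvar (ρ x)
transᵛ ρ κ (μ c)     = ¿· transᶜ (suc ∘ ρ) (lift 1 κ) c
-- Below, inside ⅋· and !ᵖ, index 0 is x and index 1 the u bound by the outer ¿·.
transᵛ ρ κ (ƛ v)     =
  ¿· (uvar zero ♯
      ⅋· ((transᵛ (lift 1 (suc ∘ ρ)) (λ γ → suc (suc (κ γ))) v ♯ lvar (suc zero)) [ !ᵖ := lvar zero ]))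
transᵉ ρ κ (covar γ) = bang (uvar (κ γ))
transᵉ ρ κ (v · e)   = bang ⟨ bang (transᵛ ρ κ v) , transᵉ ρ κ e ⟩
transᶜ ρ κ ⟨ v ∣ e ⟩ = transᵛ ρ κ v ♯ transᵉ ρ κ e

_ᵀᵛ : Term n k → Tm (n + k) 0
_ᵀᵉ : CoTerm n k → Tm (n + k) 0
_ᵀᶜ : Cmd n k → Tm (n + k) 0
_ᵀᵛ {n = n} {k = k} = transᵛ (_↑ˡ k) (n ↑ʳ_)
_ᵀᵉ {n = n} {k = k} = transᵉ (_↑ˡ k) (n ↑ʳ_)
_ᵀᶜ {n = n} {k = k} = transᶜ (_↑ˡ k) (n ↑ʳ_)

envᵀ : Vec Type n → Vec Type k → UEnv (n + k)
envᵀ Γ Θ = map (λ T → ¿ (T ᵀ)) Γ ++ᵛ map (λ T → T ᵀ ^⊥) Θ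

{-# OPTIONS --safe #-}
module Submission where

-- β¿♯! against !k = !a.(k ♯ a) substitutes (k ♯ a){a\\⋆} = k[⋆:=⋆] rather than
-- k, and likewise for β!.  So a translated step reaches the translation of the
-- contractum up to t[⋆:=⋆] ≡ t, the only structural axiom needed.  A μ-step
-- takes one reduction.  A λ-step takes three: the ¿ of the abstraction meets the
-- ! of v·e, then ⅋ meets ⊗, then the let for x meets !v.  Since !t weakens t
-- by a linear variable, everything is stated for translations into an arbitrary
-- linear scope and for an arbitrary interpretation of the (co-)variables.

open import Data.Fin using (Fin; zero; suc; lift; _↑ˡ_; _↑ʳ_)
open import Data.Maybe using (just; nothing)
open import Data.Nat using (ℕ; zero; suc; _+_)
open import Data.Product using (_×_; _,_)
open import Data.Sum using (inj₁; inj₂)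
open import Data.Vec using (Vec; []; _∷_; lookup; map)
open import Data.Vec.Functional using (insertAt)
open import Data.Vec.Properties using (lookup-++ˡ; lookup-++ʳ; lookup-map)
open import Function using (_∘_; id)
open import Relation.Binary.Construct.Closure.Equivalence as Eq using ()
open import Relation.Binary.Construct.Closure.ReflexiveTransitive as Star using (ε; _◅_; _◅◅_)
open import Relation.Binary.PropositionalEquality
  using (_≡_; _≗_; refl; sym; trans; cong; cong₂; subst; subst₂)
open import Defs

private variable
  κ κ′ : Fin k → Fin m
  ρ ρ′ : Fin n → Fin m

^⊥-involutive : ∀ A → A ^⊥ ^⊥ ≡ A
^⊥-involutive (pos α) = refl
^⊥-involutive (neg α) = refl
^⊥-involutive (A ⊗ B) = cong₂ _⊗_ (^⊥-involutive A) (^⊥-involutive B)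
^⊥-involutive (A ⅋ B) = cong₂ _⅋_ (^⊥-involutive A) (^⊥-involutive B)
^⊥-involutive 𝟏       = refl
^⊥-involutive ⊥       = refl
^⊥-involutive (! A)   = cong !_ (^⊥-involutive A)
^⊥-involutive (¿ A)   = cong ¿_ (^⊥-involutive A)

lift-cong : {φ : Fin m → Fin m′} {f : Fin n → Fin m} {g : Fin n → Fin m′} →
            φ ∘ f ≗ g → lift 1 φ ∘ lift 1 f ≗ lift 1 g
lift-cong φf≗g zero    = refl
lift-cong φf≗g (suc i) = cong suc (φf≗g i)

-- Renaming and substitution of translations

-- Translations have no free linear variables, so `θ` is arbitrary and only the interpretations
-- change. The hypotheses are pointwise because lifts of composites are compared that way, by
-- `lift-cong`.
ren-transᵛ : ∀ {φ : Fin m → Fin m′} (θ : Fin l → Fin n′) → φ ∘ ρ ≗ ρ′ → φ ∘ κ ≗ κ′ →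
             (v : Term n k) → ren φ θ (transᵛ ρ κ v) ≡ transᵛ ρ′ κ′ v
ren-transᵉ : ∀ {φ : Fin m → Fin m′} (θ : Fin l → Fin n′) → φ ∘ ρ ≗ ρ′ → φ ∘ κ ≗ κ′ →
             (e : CoTerm n k) → ren φ θ (transᵉ ρ κ e) ≡ transᵉ ρ′ κ′ e
ren-transᶜ : ∀ {φ : Fin m → Fin m′} (θ : Fin l → Fin n′) → φ ∘ ρ ≗ ρ′ → φ ∘ κ ≗ κ′ →
             (c : Cmd n k) → ren φ θ (transᶜ ρ κ c) ≡ transᶜ ρ′ κ′ c

wkₗ-transᵛ : ∀ (v : Term n k) → wkₗ zero (transᵛ {l = l} ρ κ v) ≡ transᵛ ρ κ v
wkₗ-transᵛ v = ren-transᵛ _ (λ _ → refl) (λ _ → refl) v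

wkₗ-transᵉ : ∀ (e : CoTerm n k) → wkₗ zero (transᵉ {l = l} ρ κ e) ≡ transᵉ ρ κ e
wkₗ-transᵉ e = ren-transᵉ _ (λ _ → refl) (λ _ → refl) e

-- The part of a translated abstraction that survives its first reduction, when `¿·` and `u` are
-- gone.
abs : Tm (1 + m) (2 + n) → Tm m n
abs t = ⅋· ((t ♯ lvar (suc zero)) [ !ᵖ := lvar zero ])

fun : Tm (2 + m) (2 + n) → Tm m n
fun t = ¿· (uvar zero ♯ abs t)

-- bang without the weakening of its argument.
box : Tm m (suc n) → Tm m n
box t = !· (t ♯ lvar zero)

-- A co-term translates to !k; core is this k.
core : (Fin n → Fin m) → (Fin k → Fin m) → CoTerm n k → Tm m l
core ρ κ (covar γ) = uvar (κ γ)
core ρ κ (v · e)   = ⟨ box (transᵛ ρ κ v) , transᵉ ρ κ e ⟩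

-- A translation reads the same in every linear scope, so the nested weakenings of `bang` are
-- absorbed into the implicit scope of `core`. The proof is mutual with the renaming lemmas: their
-- case `v · e` uses it, and it uses them on `v` and `e`.
transᵉ-box : ∀ (e : CoTerm n k) → transᵉ {l = l} ρ κ e ≡ box (core ρ κ e)
transᵉ-box (covar γ) = refl
transᵉ-box (v · e)   = cong box (cong₂ ⟨_,_⟩
  (cong box (trans (cong (ren _ _) (wkₗ-transᵛ v)) (ren-transᵛ _ (λ _ → refl) (λ _ → refl) v)))
  (wkₗ-transᵉ e))

ren-transᵛ θ p q (var x) = cong uvar (p x)
ren-transᵛ θ p q (μ c)   = cong ¿·_ (ren-transᶜ θ (cong suc ∘ p) (lift-cong q) c)
ren-transᵛ θ p q (ƛ v)   =
  cong fun (ren-transᵛ _ (lift-cong (cong suc ∘ p)) (cong suc ∘ cong suc ∘ q) v)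
ren-transᵉ θ p q (covar γ) = cong (λ i → bang (uvar i)) (q γ)
ren-transᵉ {φ = φ} θ p q (v · e) =
  trans (cong (ren φ θ) (transᵉ-box (v · e)))
 (trans (cong box (cong₂ ⟨_,_⟩ (cong box (ren-transᵛ _ p q v)) (ren-transᵉ _ p q e)))
        (sym (transᵉ-box (v · e))))
ren-transᶜ θ p q ⟨ v ∣ e ⟩ = cong₂ _♯_ (ren-transᵛ θ p q v) (ren-transᵉ θ p q e)

ren-core : ∀ {φ : Fin m → Fin m′} (θ : Fin l → Fin n′) → φ ∘ ρ ≗ ρ′ → φ ∘ κ ≗ κ′ →
           (e : CoTerm n k) → ren φ θ (core ρ κ e) ≡ core ρ′ κ′ e
ren-core θ p q (covar γ) = cong uvar (q γ)
ren-core θ p q (v · e)   =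
  cong₂ ⟨_,_⟩ (cong box (ren-transᵛ _ p q v)) (ren-transᵉ θ p q e)

transᵛ-ren : ∀ {f : Fin n → Fin n′} {g : Fin k → Fin a} → ρ ∘ f ≗ ρ′ → κ ∘ g ≗ κ′ →
             ∀ v → transᵛ {l = l} ρ κ (renᵛ f g v) ≡ transᵛ ρ′ κ′ v
transᵉ-ren : ∀ {f : Fin n → Fin n′} {g : Fin k → Fin a} → ρ ∘ f ≗ ρ′ → κ ∘ g ≗ κ′ →
             ∀ e → transᵉ {l = l} ρ κ (renᵉ f g e) ≡ transᵉ ρ′ κ′ e
transᶜ-ren : ∀ {f : Fin n → Fin n′} {g : Fin k → Fin a} → ρ ∘ f ≗ ρ′ → κ ∘ g ≗ κ′ →
             ∀ c → transᶜ {l = l} ρ κ (renᶜ f g c) ≡ transᶜ ρ′ κ′ c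
transᵛ-ren p q (var x) = cong uvar (p x)
transᵛ-ren p q (μ c)   = cong ¿·_ (transᶜ-ren (cong suc ∘ p) (lift-cong q) c)
transᵛ-ren p q (ƛ v)   =
  cong fun (transᵛ-ren (lift-cong (cong suc ∘ p)) (cong suc ∘ cong suc ∘ q) v)
transᵉ-ren p q (covar γ) = cong (λ i → bang (uvar i)) (q γ)
transᵉ-ren p q (v · e)   =
  cong₂ (λ t s → bang ⟨ bang t , s ⟩) (transᵛ-ren p q v) (transᵉ-ren p q e)
transᶜ-ren p q ⟨ v ∣ e ⟩ = cong₂ _♯_ (transᵛ-ren p q v) (transᵉ-ren p q e)

core-ren : ∀ {f : Fin n → Fin n′} {g : Fin k → Fin a} → ρ ∘ f ≗ ρ′ → κ ∘ g ≗ κ′ →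
           ∀ e → core {l = l} ρ κ (renᵉ f g e) ≡ core ρ′ κ′ e
core-ren p q (covar γ) = cong uvar (q γ)
core-ren p q (v · e)   = cong₂ (λ t s → ⟨ box t , s ⟩) (transᵛ-ren p q v) (transᵉ-ren p q e)

lift-var : {σ : Fin m → Tm m′ n′} {f : Fin n → Fin m} {g : Fin n → Fin m′} → σ ∘ f ≗ uvar ∘ g →
           liftᵤ 1 0 σ ∘ lift 1 f ≗ uvar ∘ lift 1 g
lift-var p zero    = refl
lift-var p (suc i) = cong (wk 1 0) (p i)

-- Disposes of substitutions that undo a weakening or replace a variable without occurrences: on the
-- variables in use `σ` is a renaming, and `τ` meets no linear variable.
sub-transᵛ : ∀ {σ : Fin m → Tm m′ n′} {τ : Fin l → Tm m′ n′} →
             σ ∘ ρ ≗ uvar ∘ ρ′ → σ ∘ κ ≗ uvar ∘ κ′ →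
             (v : Term n k) → sub σ τ (transᵛ ρ κ v) ≡ transᵛ ρ′ κ′ v
sub-transᵉ : ∀ {σ : Fin m → Tm m′ n′} {τ : Fin l → Tm m′ n′} →
             σ ∘ ρ ≗ uvar ∘ ρ′ → σ ∘ κ ≗ uvar ∘ κ′ →
             (e : CoTerm n k) → sub σ τ (transᵉ ρ κ e) ≡ transᵉ ρ′ κ′ e
sub-transᶜ : ∀ {σ : Fin m → Tm m′ n′} {τ : Fin l → Tm m′ n′} →
             σ ∘ ρ ≗ uvar ∘ ρ′ → σ ∘ κ ≗ uvar ∘ κ′ →
             (c : Cmd n k) → sub σ τ (transᶜ ρ κ c) ≡ transᶜ ρ′ κ′ c
sub-transᵛ p q (var x) = p x
sub-transᵛ p q (μ c)   = cong ¿·_ (sub-transᶜ (cong (wk 1 0) ∘ p) (lift-var q) c)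
sub-transᵛ p q (ƛ v)   =
  cong fun (sub-transᵛ (lift-var (cong (wk 0 2 ∘ wk 1 0) ∘ p))
                       (cong (wk 1 0 ∘ wk 0 2 ∘ wk 1 0) ∘ q) v)
sub-transᵉ p q (covar γ) = cong box (cong (wk 0 1) (q γ))
sub-transᵉ {σ = σ} {τ} p q (v · e) =
  trans (cong (sub σ τ) (transᵉ-box (v · e)))
 (trans (cong box (cong₂ ⟨_,_⟩ (cong box (sub-transᵛ (cong (wk 0 1 ∘ wk 0 1) ∘ p)
                                                     (cong (wk 0 1 ∘ wk 0 1) ∘ q) v))
                               (sub-transᵉ (cong (wk 0 1) ∘ p) (cong (wk 0 1) ∘ q) e)))
        (sym (transᵉ-box (v · e))))
sub-transᶜ p q ⟨ v ∣ e ⟩ = cong₂ _♯_ (sub-transᵛ p q v) (sub-transᵉ p q e)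

-- Typing of translations

split-∅ : ∅ {n} ≔ ∅ ⊎ ∅
split-∅ {zero}  = []
split-∅ {suc n} = none split-∅

⊢-type : A ≡ B → Δ ⨾ Γ ⊢ t ∶ A → Δ ⨾ Γ ⊢ t ∶ B
⊢-type refl t = t

-- The double negation is kept on purpose: at the types of `⊢fun` the result is definitionally
-- `(S ⊃ T) ᵀ ^⊥ ^⊥`, which the cut against `u` demands.
⊢abs : A ∷ Δ ⨾ ∅ {2 + n} ⊢ t ∶ B → Δ ⨾ ∅ ⊢ abs t ∶ (! A) ^⊥ ⅋ B ^⊥ ^⊥
⊢abs t = ⊢⅋ (⊢!ᵖ (inˡ (inʳ split-∅)) (⊢lvar zero) (⊢♯ (none (inʳ split-∅)) t (⊢lvar (suc zero))))

-- The linear variable cut against `t` has type `B ^⊥`, and `⊢!` negates it again; hence the cast.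
⊢box : {t : Tm m (suc n)} → Δ ⨾ ∅ ⊢ t ∶ B → Δ ⨾ ∅ ⊢ box t ∶ ! B
⊢box {B = B} t = ⊢-type (cong !_ (^⊥-involutive B))
  (⊢! (⊢♯ (inʳ split-∅) t (⊢lvar zero)))

module _ (S T : Type) (Δ : UEnv m) where

  -- ⊢¿ and ⊢⅋ dictate the types of u and a, so x : ¿ Sᵀ only up to involution.
  bodyEnv : UEnv (2 + m)
  bodyEnv = ¿ (S ᵀ ^⊥ ^⊥) ∷ (S ⊃ T) ᵀ ^⊥ ∷ Δ

  ⊢fun : bodyEnv ⨾ ∅ {2 + n} ⊢ t ∶ ¿ (T ᵀ) → Δ ⨾ ∅ ⊢ fun t ∶ ¿ ((S ⊃ T) ᵀ)
  ⊢fun t = ⊢¿ (⊢♯ split-∅ (⊢uvar zero) (⊢abs t))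

  ξfun : ∀ {R : ∀ {m n} → Tm m n → Tm m n → Set} →
         Closure R bodyEnv (∅ {2 + n}) (¿ (T ᵀ)) t s → Closure R Δ ∅ (¿ ((S ⊃ T) ᵀ)) (fun t) (fun s)
  ξfun r = ξ¿ (ξ♯ʳ split-∅ (⊢uvar zero)
    (ξ⅋ (ξ!ᵖˡ (inˡ (inʳ split-∅)) (⊢lvar zero) (ξ♯ˡ (none (inʳ split-∅)) r (⊢lvar (suc zero))))))

ξbox : ∀ {R : ∀ {m n} → Tm m n → Tm m n → Set} {t s : Tm m (suc n)} →
       Closure R Δ ∅ B t s → Closure R Δ ∅ (! B) (box t) (box s)
ξbox {B = B} r = subst (λ A → Closure _ _ _ (! A) _ _) (^⊥-involutive B)
  (ξ! (ξ♯ˡ (inʳ split-∅) r (⊢lvar zero)))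

-- The block shape of `envᵀ` is lost under binders: `μ` puts its co-variable in front of all
-- variables, and `ƛ` adds `u`. These two lookups are what stays invariant.
record Interp (Δ : UEnv m) (ρ : Fin n → Fin m) (κ : Fin k → Fin m)
              (Γ : Vec Type n) (Θ : Vec Type k) : Set where
  field
    var-type   : ∀ x → lookup Δ (ρ x) ≡ ¿ (lookup Γ x ᵀ)
    covar-type : ∀ γ → lookup Δ (κ γ) ≡ lookup Θ γ ᵀ ^⊥
open Interp

private variable
  Ξ Ξ′ : Vec Type n
  Θ Θ′ : Vec Type k

Interp-wk : Interp {m} Δ ρ κ Ξ Θ → Interp (A ∷ Δ) (suc ∘ ρ) (suc ∘ κ) Ξ Θ
Interp-wk I .var-type   = I .var-type
Interp-wk I .covar-type = I .covar-type

Interp-μ : Interp {m} Δ ρ κ Ξ Θ → Interp (T ᵀ ^⊥ ∷ Δ) (suc ∘ ρ) (lift 1 κ) Ξ (T ∷ Θ)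
Interp-μ I .var-type           = I .var-type
Interp-μ I .covar-type zero    = refl
Interp-μ I .covar-type (suc γ) = I .covar-type γ

-- The equation is an argument because `x` is typed up to involution inside `abs`, but by `¿ (S ᵀ)`
-- itself in the let that `β-app` produces.
Interp-x : A ≡ ¿ (S ᵀ) → Interp {m} Δ ρ κ Ξ Θ → Interp (A ∷ Δ) (lift 1 ρ) (suc ∘ κ) (S ∷ Ξ) Θ
Interp-x A≡ I .var-type zero    = A≡
Interp-x A≡ I .var-type (suc x) = I .var-type x
Interp-x A≡ I .covar-type       = I .covar-type

Interp-ƛ : Interp {m} Δ ρ κ Ξ Θ →
           Interp (bodyEnv S T Δ) (lift 1 (suc ∘ ρ)) (λ γ → suc (suc (κ γ))) (S ∷ Ξ) Θ
Interp-ƛ I = Interp-x (cong ¿_ (^⊥-involutive _)) (Interp-wk I)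

⊢transᵛ : ∀ {v : Term n k} → Interp {m} Δ ρ κ Ξ Θ → Ξ ⊢ v ∶ T ∣ Θ →
          Δ ⨾ ∅ {l} ⊢ transᵛ ρ κ v ∶ ¿ (T ᵀ)
⊢transᵉ : ∀ {e : CoTerm n k} → Interp {m} Δ ρ κ Ξ Θ → Ξ ∣ e ∶ T ⊢ Θ →
          Δ ⨾ ∅ {l} ⊢ transᵉ ρ κ e ∶ ! (T ᵀ ^⊥)
⊢transᶜ : ∀ {c : Cmd n k} → Interp {m} Δ ρ κ Ξ Θ → c ∶[ Ξ ⊢ Θ ] →
          Δ ⨾ ∅ {l} ⊢ transᶜ ρ κ c ∶ ⊥
⊢core   : ∀ {e : CoTerm n k} → Interp {m} Δ ρ κ Ξ Θ → Ξ ∣ e ∶ T ⊢ Θ →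
          Δ ⨾ ∅ {l} ⊢ core ρ κ e ∶ T ᵀ ^⊥
⊢transᵛ I (var x) = ⊢-type (I .var-type x) (⊢uvar _)
⊢transᵛ I (μ c)   = ⊢¿ (⊢transᶜ (Interp-μ I) c)
⊢transᵛ I (ƛ v)   = ⊢fun _ _ _ (⊢transᵛ (Interp-ƛ I) v)
⊢transᵉ {e = e} I ⊢e = subst (λ t → _ ⨾ ∅ ⊢ t ∶ _) (sym (transᵉ-box e)) (⊢box (⊢core I ⊢e))
⊢transᶜ I ⟨ v ∣ e ⟩ = ⊢♯ split-∅ (⊢transᵛ I v) (⊢transᵉ I e)
⊢core I (covar γ) = ⊢-type (I .covar-type γ) (⊢uvar _)
⊢core {l = l} I (_·_ {S = S} v e) =
  -- Dualising `¿ ! (S ᵀ ^⊥)` leaves `S ᵀ ^⊥ ^⊥` under the `¿`, so the argument is cast.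
  ⊢pair split-∅ (⊢box (⊢-type (cong ¿_ (sym (^⊥-involutive (S ᵀ)))) (⊢transᵛ I v)))
                (⊢transᵉ I e)

-- The equivalence part of β-reduction

infix 4 _⨾_⊢_≃_∶_
-- A reflexive `Equivalence` carries no typing, while congruence under a binary constructor needs
-- the typing of the sibling. `typedˡ` also types the raw contractum, as `axiom` requires of a
-- reduction step.
record _⨾_⊢_≃_∶_ (Δ : UEnv m) (Γ : LEnv n) (t s : Tm m n) (A : Form) : Set where
  constructor mk≃
  field
    typedˡ : Δ ⨾ Γ ⊢ t ∶ A
    typedʳ : Δ ⨾ Γ ⊢ s ∶ A
    equiv  : Equivalence Δ Γ A t s
open _⨾_⊢_≃_∶_

≃-map : {Δ : UEnv m} {Δ′ : UEnv m′} {Γ : LEnv n} {Γ′ : LEnv n′} (f : Tm m n → Tm m′ n′) →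
        (∀ {t} → Δ ⨾ Γ ⊢ t ∶ A → Δ′ ⨾ Γ′ ⊢ f t ∶ B) →
        (∀ {t s} → Closure _≅_ Δ Γ A t s → Closure _≅_ Δ′ Γ′ B (f t) (f s)) →
        Δ ⨾ Γ ⊢ t ≃ s ∶ A → Δ′ ⨾ Γ′ ⊢ f t ≃ f s ∶ B
≃-map f ⊢f ξf (mk≃ t s e) = mk≃ (⊢f t) (⊢f s) (Eq.gmap f ξf e)

≃-refl : Δ ⨾ Γ ⊢ t ∶ A → Δ ⨾ Γ ⊢ t ≃ t ∶ A
≃-refl t = mk≃ t t ε

≃-trans : Δ ⨾ Γ ⊢ t ≃ s ∶ A → Δ ⨾ Γ ⊢ s ≃ r ∶ A → Δ ⨾ Γ ⊢ t ≃ r ∶ A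
≃-trans (mk≃ t _ e) (mk≃ _ r f) = mk≃ t r (e ◅◅ f)

≃-♯ : Γ ≔ Γ₁ ⊎ Γ₂ → Δ ⨾ Γ₁ ⊢ t ≃ t′ ∶ B → Δ ⨾ Γ₂ ⊢ s ≃ s′ ∶ B ^⊥ → Δ ⨾ Γ ⊢ t ♯ s ≃ t′ ♯ s′ ∶ ⊥
≃-♯ p t s = ≃-trans (≃-map (_♯ _) (λ t → ⊢♯ p t (s .typedˡ)) (λ r → ξ♯ˡ p r (s .typedˡ)) t)
                    (≃-map (_ ♯_) (⊢♯ p (t .typedʳ)) (ξ♯ʳ p (t .typedʳ)) s)

≃-pair : Γ ≔ Γ₁ ⊎ Γ₂ → Δ ⨾ Γ₁ ⊢ t ≃ t′ ∶ A → Δ ⨾ Γ₂ ⊢ s ≃ s′ ∶ B →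
         Δ ⨾ Γ ⊢ ⟨ t , s ⟩ ≃ ⟨ t′ , s′ ⟩ ∶ A ⊗ B
≃-pair p t s =
  ≃-trans (≃-map ⟨_, _ ⟩ (λ t → ⊢pair p t (s .typedˡ)) (λ r → ξpairˡ p r (s .typedˡ)) t)
          (≃-map ⟨ _ ,_⟩ (⊢pair p (t .typedʳ)) (ξpairʳ p (t .typedʳ)) s)

infix 4 _≐_
-- The discrepancy allowed at a single variable. Being syntactic, it is stable under the renamings
-- made when a substitution crosses a binder.
data _≐_ {m n} : Tm m n → Tm m n → Set where
  refl : t ≐ t
  unit : t [ ⋆ᵖ := ⋆ ] ≐ t

≐⇒≃ : {t s : Tm m n} → t ≐ s → Δ ⨾ ∅ ⊢ s ∶ A → Δ ⨾ ∅ ⊢ t ≃ s ∶ A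
≐⇒≃ refl s = ≃-refl s
≐⇒≃ unit s = mk≃ ⊢t⋆ s (Eq.return (axiom ⋆-unit ⊢t⋆ s))
  where ⊢t⋆ = ⊢⋆ᵖ split-∅ ⊢⋆ s

≐-ren : {t s : Tm m n} (φ : Fin m → Fin m′) (θ : Fin n → Fin n′) → t ≐ s → ren φ θ t ≐ ren φ θ s
≐-ren φ θ refl = refl
≐-ren φ θ unit = unit

-- Typed substitutions of expressions and their simulation

⊢renᵛ : ∀ {f : Fin n → Fin n′} {g : Fin k → Fin l} {v T} →
        lookup Ξ′ ∘ f ≗ lookup Ξ → lookup Θ′ ∘ g ≗ lookup Θ →
        Ξ ⊢ v ∶ T ∣ Θ → Ξ′ ⊢ renᵛ f g v ∶ T ∣ Θ′
⊢renᵉ : ∀ {f : Fin n → Fin n′} {g : Fin k → Fin l} {e T} →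
        lookup Ξ′ ∘ f ≗ lookup Ξ → lookup Θ′ ∘ g ≗ lookup Θ →
        Ξ ∣ e ∶ T ⊢ Θ → Ξ′ ∣ renᵉ f g e ∶ T ⊢ Θ′
⊢renᶜ : ∀ {f : Fin n → Fin n′} {g : Fin k → Fin l} {c} →
        lookup Ξ′ ∘ f ≗ lookup Ξ → lookup Θ′ ∘ g ≗ lookup Θ →
        c ∶[ Ξ ⊢ Θ ] → renᶜ f g c ∶[ Ξ′ ⊢ Θ′ ]
⊢renᵛ p q (var x) = subst (_ ⊢ _ ∶_∣ _) (p x) (var _)
⊢renᵛ p q (μ c)   = μ (⊢renᶜ p (λ { zero → refl ; (suc γ) → q γ }) c)
⊢renᵛ p q (ƛ v)   = ƛ (⊢renᵛ (λ { zero → refl ; (suc x) → p x }) q v)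
⊢renᵉ p q (covar γ) = subst (_ ∣ _ ∶_⊢ _) (q γ) (covar _)
⊢renᵉ p q (v · e)   = ⊢renᵛ p q v · ⊢renᵉ p q e
⊢renᶜ p q ⟨ v ∣ e ⟩ = ⟨ ⊢renᵛ p q v ∣ ⊢renᵉ p q e ⟩

-- σ̂ acts on translations as (σ , τ) does on expressions, up to ⋆-unit; a
-- co-variable γ is sent to the core of τ γ as γᵀ is !γ.
record Simulates (Ξ : Vec Type n) (Θ : Vec Type k) (Ξ′ : Vec Type n′) (Θ′ : Vec Type a)
                 (ρ : Fin n → Fin m) (κ : Fin k → Fin m)
                 (ρ′ : Fin n′ → Fin m′) (κ′ : Fin a → Fin m′)
                 (σ : Fin n → Term n′ a) (τ : Fin k → CoTerm n′ a)
                 (σ̂ : Fin m → Tm m′ l) : Set where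
  field
    ⊢σ : ∀ x → Ξ′ ⊢ σ x ∶ lookup Ξ x ∣ Θ′
    ⊢τ : ∀ γ → Ξ′ ∣ τ γ ∶ lookup Θ γ ⊢ Θ′
    σ≐ : ∀ x → σ̂ (ρ x) ≐ transᵛ ρ′ κ′ (σ x)
    τ≐ : ∀ γ → σ̂ (κ γ) ≐ core ρ′ κ′ (τ γ)
open Simulates

module _ {σ : Fin n → Term n′ a} {τ : Fin k → CoTerm n′ a} {σ̂ : Fin m → Tm m′ l}
         {κ : Fin k → Fin m} {κ′ : Fin a → Fin m′} where

  Simulates-wkₗ : ∀ b → Simulates Ξ Θ Ξ′ Θ′ ρ κ ρ′ κ′ σ τ σ̂ →
                  Simulates Ξ Θ Ξ′ Θ′ ρ κ ρ′ κ′ σ τ (wk 0 b ∘ σ̂)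
  Simulates-wkₗ b H .⊢σ   = H .⊢σ
  Simulates-wkₗ b H .⊢τ   = H .⊢τ
  Simulates-wkₗ b H .σ≐ x =
    subst (_ ≐_) (ren-transᵛ _ (λ _ → refl) (λ _ → refl) (σ x)) (≐-ren _ _ (H .σ≐ x))
  Simulates-wkₗ b H .τ≐ γ =
    subst (_ ≐_) (ren-core _ (λ _ → refl) (λ _ → refl) (τ γ)) (≐-ren _ _ (H .τ≐ γ))

  -- For a binder without counterpart in the expression, namely the `u` of an abstraction. It also
  -- settles the old variables under binders that do have one.
  Simulates-wkᵤ : Simulates Ξ Θ Ξ′ Θ′ ρ κ ρ′ κ′ σ τ σ̂ →
                  Simulates Ξ Θ Ξ′ Θ′ (suc ∘ ρ) (suc ∘ κ) (suc ∘ ρ′) (suc ∘ κ′) σ τ (liftᵤ 1 0 σ̂)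
  Simulates-wkᵤ H .⊢σ   = H .⊢σ
  Simulates-wkᵤ H .⊢τ   = H .⊢τ
  Simulates-wkᵤ H .σ≐ x =
    subst (_ ≐_) (ren-transᵛ _ (λ _ → refl) (λ _ → refl) (σ x)) (≐-ren _ _ (H .σ≐ x))
  Simulates-wkᵤ H .τ≐ γ =
    subst (_ ≐_) (ren-core _ (λ _ → refl) (λ _ → refl) (τ γ)) (≐-ren _ _ (H .τ≐ γ))

  Simulates-x : Simulates Ξ Θ Ξ′ Θ′ ρ κ ρ′ κ′ σ τ σ̂ →
                Simulates (S ∷ Ξ) Θ (S ∷ Ξ′) Θ′ (lift 1 ρ) (suc ∘ κ) (lift 1 ρ′) (suc ∘ κ′)
                  (insertAt (renᵛ suc id ∘ σ) zero (var zero)) (renᵉ suc id ∘ τ) (liftᵤ 1 0 σ̂)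
  Simulates-x H .⊢σ zero    = var zero
  Simulates-x H .⊢σ (suc x) = ⊢renᵛ (λ _ → refl) (λ _ → refl) (H .⊢σ x)
  Simulates-x H .⊢τ γ       = ⊢renᵉ (λ _ → refl) (λ _ → refl) (H .⊢τ γ)
  Simulates-x H .σ≐ zero    = refl
  Simulates-x H .σ≐ (suc x) =
    subst (_ ≐_) (sym (transᵛ-ren (λ _ → refl) (λ _ → refl) (σ x))) (Simulates-wkᵤ H .σ≐ x)
  Simulates-x H .τ≐ γ       =
    subst (_ ≐_) (sym (core-ren (λ _ → refl) (λ _ → refl) (τ γ))) (Simulates-wkᵤ H .τ≐ γ)

  Simulates-μ : Simulates Ξ Θ Ξ′ Θ′ ρ κ ρ′ κ′ σ τ σ̂ →
                Simulates Ξ (T ∷ Θ) Ξ′ (T ∷ Θ′) (suc ∘ ρ) (lift 1 κ) (suc ∘ ρ′) (lift 1 κ′)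
                  (renᵛ id suc ∘ σ) (insertAt (renᵉ id suc ∘ τ) zero (covar zero)) (liftᵤ 1 0 σ̂)
  Simulates-μ H .⊢σ x       = ⊢renᵛ (λ _ → refl) (λ _ → refl) (H .⊢σ x)
  Simulates-μ H .⊢τ zero    = covar zero
  Simulates-μ H .⊢τ (suc γ) = ⊢renᵉ (λ _ → refl) (λ _ → refl) (H .⊢τ γ)
  Simulates-μ H .σ≐ x       =
    subst (_ ≐_) (sym (transᵛ-ren (λ _ → refl) (λ _ → refl) (σ x))) (Simulates-wkᵤ H .σ≐ x)
  Simulates-μ H .τ≐ zero    = refl
  Simulates-μ H .τ≐ (suc γ) =
    subst (_ ≐_) (sym (core-ren (λ _ → refl) (λ _ → refl) (τ γ))) (Simulates-wkᵤ H .τ≐ γ)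

-- All cases but the variables are congruences. Co-terms pass through `core`: replacing γ inside
-- `box` by the core of `τ γ` gives the translation of `τ γ`.
≃-transᵛ : ∀ {Δ : UEnv m} {σ τ} {σ̂ : Fin m′ → Tm m l} {τ̂ : Fin n′ → Tm m l} {v : Term n k} →
           Simulates Ξ Θ Ξ′ Θ′ ρ κ ρ′ κ′ σ τ σ̂ → Interp Δ ρ′ κ′ Ξ′ Θ′ → Ξ ⊢ v ∶ T ∣ Θ →
           Δ ⨾ ∅ ⊢ sub σ̂ τ̂ (transᵛ ρ κ v) ≃ transᵛ ρ′ κ′ (subᵛ σ τ v) ∶ ¿ (T ᵀ)
≃-transᵉ : ∀ {Δ : UEnv m} {σ τ} {σ̂ : Fin m′ → Tm m l} {τ̂ : Fin n′ → Tm m l} {e : CoTerm n k} →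
           Simulates Ξ Θ Ξ′ Θ′ ρ κ ρ′ κ′ σ τ σ̂ → Interp Δ ρ′ κ′ Ξ′ Θ′ → Ξ ∣ e ∶ T ⊢ Θ →
           Δ ⨾ ∅ ⊢ sub σ̂ τ̂ (transᵉ ρ κ e) ≃ transᵉ ρ′ κ′ (subᵉ σ τ e) ∶ ! (T ᵀ ^⊥)
≃-transᶜ : ∀ {Δ : UEnv m} {σ τ} {σ̂ : Fin m′ → Tm m l} {τ̂ : Fin n′ → Tm m l} {c : Cmd n k} →
           Simulates Ξ Θ Ξ′ Θ′ ρ κ ρ′ κ′ σ τ σ̂ → Interp Δ ρ′ κ′ Ξ′ Θ′ → c ∶[ Ξ ⊢ Θ ] →
           Δ ⨾ ∅ ⊢ sub σ̂ τ̂ (transᶜ ρ κ c) ≃ transᶜ ρ′ κ′ (subᶜ σ τ c) ∶ ⊥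
≃-core   : ∀ {Δ : UEnv m} {σ τ} {σ̂ : Fin m′ → Tm m l} {τ̂ : Fin n′ → Tm m l} {e : CoTerm n k} →
           Simulates Ξ Θ Ξ′ Θ′ ρ κ ρ′ κ′ σ τ σ̂ → Interp Δ ρ′ κ′ Ξ′ Θ′ → Ξ ∣ e ∶ T ⊢ Θ →
           Δ ⨾ ∅ ⊢ sub σ̂ τ̂ (core ρ κ e) ≃ core ρ′ κ′ (subᵉ σ τ e) ∶ T ᵀ ^⊥
≃-transᵛ H I (var x) = ≐⇒≃ (H .σ≐ x) (⊢transᵛ I (H .⊢σ x))
≃-transᵛ H I (μ c)   = ≃-map ¿·_ ⊢¿ ξ¿ (≃-transᶜ (Simulates-μ H) (Interp-μ I) c)
≃-transᵛ H I (ƛ v)   = ≃-map fun (⊢fun _ _ _) (ξfun _ _ _)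
  -- From the inside out: `u`, the two linear variables of `⅋·`, then `x`.
  (≃-transᵛ (Simulates-x (Simulates-wkₗ 2 (Simulates-wkᵤ H))) (Interp-ƛ I) v)
≃-transᵉ {Δ = Δ} {σ} {τ} {σ̂ = σ̂} {τ̂} {e} H I ⊢e =
  subst₂ (λ t s → Δ ⨾ ∅ ⊢ t ≃ s ∶ _)
    (sym (cong (sub σ̂ τ̂) (transᵉ-box e))) (sym (transᵉ-box (subᵉ σ τ e)))
    (≃-map box ⊢box ξbox (≃-core (Simulates-wkₗ 1 H) I ⊢e))
≃-transᶜ H I ⟨ v ∣ e ⟩ = ≃-♯ split-∅ (≃-transᵛ H I v) (≃-transᵉ H I e)
≃-core H I (covar γ) = ≐⇒≃ (H .τ≐ γ) (⊢core I (H .⊢τ γ))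
≃-core {Δ = Δ} H I (_·_ {S = S} v e) = ≃-pair split-∅
  (≃-map box ⊢box ξbox (subst (λ A → Δ ⨾ ∅ ⊢ _ ≃ _ ∶ ¿ A) (sym (^⊥-involutive (S ᵀ)))
    (≃-transᵛ (Simulates-wkₗ 1 H) I v)))
  (≃-transᵉ H I e)

-- Simulation of reduction steps

step : PreReduction Δ Γ A t s → Δ ⨾ Γ ⊢ t ↠ s ∶ A
step r = inj₁ (_ , _ , ε , r , ε) ◅ ε

≃⇒↠ : Δ ⨾ Γ ⊢ t ≃ s ∶ A → Δ ⨾ Γ ⊢ t ↠ s ∶ A
≃⇒↠ t≃s = inj₂ (t≃s .equiv) ◅ ε

-- `ξf` is polymorphic in `R` because one reduction mixes the closures of `↦` and `≅`.
↠-map : {Δ : UEnv m} {Δ′ : UEnv m′} {Γ : LEnv n} {Γ′ : LEnv n′} (f : Tm m n → Tm m′ n′) →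
        (∀ {R : ∀ {m n} → Tm m n → Tm m n → Set} {t s} →
           Closure R Δ Γ A t s → Closure R Δ′ Γ′ B (f t) (f s)) →
        Δ ⨾ Γ ⊢ t ↠ s ∶ A → Δ′ ⨾ Γ′ ⊢ f t ↠ f s ∶ B
↠-map f ξf = Star.gmap f λ where
  (inj₁ (_ , _ , e , r , e′)) → inj₁ (_ , _ , Eq.gmap f ξf e , ξf r , Eq.gmap f ξf e′)
  (inj₂ e)                    → inj₂ (Eq.gmap f ξf e)

-- The redex needs a literally weakened core, the contractum the core in the outer scope; `ren-core`
-- converts both. The renaming of `t` left by the empty contexts is kept, to be removed once `t` is
-- a known translation.
β-core : ∀ (ρ : Fin n → Fin m) (κ : Fin k → Fin m) (t : Tm (suc m) l) e →
         ¿· t ♯ transᵉ ρ κ e ↦ ren (lift 1 id) id t ⟪ zero :=ᵤ core ρ κ e [ ⋆ᵖ := ⋆ ] ⟫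
β-core ρ κ t e = subst₂ (λ s r → ¿· t ♯ s ↦ ren (lift 1 id) id t ⟪ zero :=ᵤ r [ ⋆ᵖ := ⋆ ] ⟫)
  (trans (cong box (ren-core _ (λ _ → refl) (λ _ → refl) e)) (sym (transᵉ-box e)))
  (ren-core _ (λ _ → refl) (λ _ → refl) e)
  -- Contra-substituting ⋆ for a in k ♯ a descends to the right and returns k under a residual
  -- `[ ⋆ᵖ := ⋆ ]`.
  (β¿♯! □ □ (\\♯₂ \\var))

-- Here a becomes the boxed argument and b the translation of `e`. The latter lands below the let
-- for `x`, hence `suc ∘ ρ` and `suc ∘ κ`; the rest erases renamings and vacuous substitutions.
β-app : ∀ {ρ : Fin n → Fin m} {κ : Fin k → Fin m} (v : Term (suc n) k) w e →
        core {l = l} ρ κ (w · e) ♯ abs (transᵛ (lift 1 ρ) (suc ∘ κ) v) ↦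
        (transᵛ (lift 1 ρ) (suc ∘ κ) v ♯ transᵉ (suc ∘ ρ) (suc ∘ κ) e) [ !ᵖ := box (transᵛ ρ κ w) ]
β-app {ρ = ρ} {κ} v w e =
  subst (λ t → core ρ κ (w · e) ♯ abs (transᵛ (lift 1 ρ) (suc ∘ κ) v) ↦ t)
    (cong₂ _[ !ᵖ :=_]
      (cong₂ _♯_
        (trans (cong (sub _ _ ∘ sub _ _) (ren-transᵛ _ (lift-cong (λ _ → refl)) (λ _ → refl) v))
        (trans (cong (sub _ _) (sub-transᵛ (lift-var (λ _ → refl)) (λ _ → refl) v))
               (sub-transᵛ (lift-var (λ _ → refl)) (λ _ → refl) v)))
        (trans (cong (wk 1 0) (ren-transᵉ _ (λ _ → refl) (λ _ → refl) e))
               (ren-transᵉ _ (λ _ → refl) (λ _ → refl) e)))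
      (cong box
        (trans (cong (sub _ _ ∘ ren _ _) (ren-transᵛ _ (λ _ → refl) (λ _ → refl) w))
        (trans (cong (sub _ _) (ren-transᵛ _ (λ _ → refl) (λ _ → refl) w))
               (sub-transᵛ (λ _ → refl) (λ _ → refl) w)))))
    (β⊗♯⅋ □ □)

β-box : ∀ (ρ : Fin n → Fin m) (κ : Fin k → Fin m) (t : Tm (suc m) l) w →
        t [ !ᵖ := box (transᵛ ρ κ w) ] ↦
        ren (lift 1 id) id t ⟪ zero :=ᵤ transᵛ ρ κ w [ ⋆ᵖ := ⋆ ] ⟫
β-box ρ κ t w = subst
  (λ s → t [ !ᵖ := box s ] ↦ ren (lift 1 id) id t ⟪ zero :=ᵤ transᵛ ρ κ w [ ⋆ᵖ := ⋆ ] ⟫)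
  (wkₗ-transᵛ w) (β! □ (\\♯₂ \\var))

-- Only the substituted variable picks up the residue of contra-substitution, through `unit`;
-- likewise for a co-variable below.
Simulates-[x] : ∀ {ρ : Fin n → Fin m} {κ : Fin k → Fin m} {w : Term n k} → Ξ ⊢ w ∶ S ∣ Θ →
  Simulates (S ∷ Ξ) Θ Ξ Θ (lift 1 ρ) (suc ∘ κ) ρ κ (insertAt var zero w) covar
    (insertAt (uvar {n = l}) zero (transᵛ ρ κ w [ ⋆ᵖ := ⋆ ]))
Simulates-[x] w .⊢σ zero    = w
Simulates-[x] w .⊢σ (suc x) = var x
Simulates-[x] w .⊢τ γ       = covar γ
Simulates-[x] w .σ≐ zero    = unit
Simulates-[x] w .σ≐ (suc x) = refl
Simulates-[x] w .τ≐ γ       = refl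

Simulates-[γ] : ∀ {ρ : Fin n → Fin m} {κ : Fin k → Fin m} {e : CoTerm n k} → Ξ ∣ e ∶ T ⊢ Θ →
  Simulates Ξ (T ∷ Θ) Ξ Θ (suc ∘ ρ) (lift 1 κ) ρ κ var (insertAt covar zero e)
    (insertAt (uvar {n = l}) zero (core ρ κ e [ ⋆ᵖ := ⋆ ]))
Simulates-[γ] e .⊢σ x       = var x
Simulates-[γ] e .⊢τ zero    = e
Simulates-[γ] e .⊢τ (suc γ) = covar γ
Simulates-[γ] e .σ≐ x       = refl
Simulates-[γ] e .τ≐ zero    = unit
Simulates-[γ] e .τ≐ (suc γ) = refl

↠-μ : ∀ {ρ : Fin n → Fin m} {κ : Fin k → Fin m} {c e} → Interp Δ ρ κ Ξ Θ →
      c ∶[ Ξ ⊢ T ∷ Θ ] → Ξ ∣ e ∶ T ⊢ Θ →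
      Δ ⨾ ∅ {l} ⊢ transᶜ ρ κ ⟨ μ c ∣ e ⟩ ↠ transᶜ ρ κ (c [γ:= e ]) ∶ ⊥
↠-μ {ρ = ρ} {κ} {c} {e} I ⊢c ⊢e =
  step (axiom redex (⊢transᶜ I ⟨ μ ⊢c ∣ ⊢e ⟩) (c≃ .typedˡ)) ◅◅ ≃⇒↠ c≃
  where
  redex = subst (λ t → transᶜ ρ κ ⟨ μ c ∣ e ⟩ ↦ t ⟪ zero :=ᵤ core ρ κ e [ ⋆ᵖ := ⋆ ] ⟫)
    (ren-transᶜ _ (λ _ → refl) (lift-cong (λ _ → refl)) c) (β-core ρ κ _ e)
  c≃ = ≃-transᶜ (Simulates-[γ] ⊢e) I ⊢c

↠-β : ∀ {ρ : Fin n → Fin m} {κ : Fin k → Fin m} {v w e} → Interp Δ ρ κ Ξ Θ →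
      S ∷ Ξ ⊢ v ∶ T ∣ Θ → Ξ ⊢ w ∶ S ∣ Θ → Ξ ∣ e ∶ T ⊢ Θ →
      Δ ⨾ ∅ {l} ⊢ transᶜ ρ κ ⟨ ƛ v ∣ w · e ⟩ ↠ transᶜ ρ κ ⟨ v [x:= w ] ∣ e ⟩ ∶ ⊥
↠-β {S = S} {T = T} {ρ = ρ} {κ} {v} {w} {e} I ⊢v ⊢w ⊢e =
  step (axiom redex₁ (⊢transᶜ I ⟨ ƛ ⊢v ∣ ⊢w · ⊢e ⟩) (unit≃ .typedˡ)) ◅◅
  -- Removing the residual ⋆ exposes the pair, so that `β-app` works with empty contexts.
  ≃⇒↠ unit≃ ◅◅
  step (axiom (β-app v w e) (unit≃ .typedʳ) ⊢let) ◅◅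
  step (axiom redex₂ ⊢let (v≃ .typedˡ)) ◅◅
  ≃⇒↠ v≃
  where
  -- Left general in its linear scope: it is needed both under `⅋·` and after that binder is
  -- consumed.
  V : Tm _ a
  V = transᵛ (lift 1 ρ) (suc ∘ κ) v
  redex₁ : transᶜ ρ κ ⟨ ƛ v ∣ w · e ⟩ ↦ core ρ κ (w · e) [ ⋆ᵖ := ⋆ ] ♯ abs V
  redex₁ = subst (λ t → transᶜ ρ κ ⟨ ƛ v ∣ w · e ⟩ ↦ core ρ κ (w · e) [ ⋆ᵖ := ⋆ ] ♯ abs t)
    -- `u` does not occur in the body, so replacing it merely undoes the weakening.
    (trans (cong (sub _ _) (ren-transᵛ _ (lift-cong (λ _ → refl)) (λ _ → refl) v))
           (sub-transᵛ (lift-var (λ _ → refl)) (λ _ → refl) v))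
    (β-core ρ κ _ (w · e))
  unit≃ = ≃-♯ {B = (S ⊃ T) ᵀ ^⊥} split-∅ (≐⇒≃ unit (⊢core I (⊢w · ⊢e)))
    (≃-refl (⊢abs (⊢transᵛ (Interp-x (cong ¿_ (^⊥-involutive (S ᵀ))) I) ⊢v)))
  ⊢let = ⊢!ᵖ split-∅ (⊢box (⊢transᵛ I ⊢w))
    (⊢♯ split-∅ (⊢transᵛ (Interp-x refl I) ⊢v) (⊢transᵉ (Interp-wk I) ⊢e))
  redex₂ : (V ♯ transᵉ (suc ∘ ρ) (suc ∘ κ) e) [ !ᵖ := box (transᵛ ρ κ w) ] ↦
           V ⟪ zero :=ᵤ transᵛ ρ κ w [ ⋆ᵖ := ⋆ ] ⟫ ♯ transᵉ ρ κ e
  redex₂ = subst ((V ♯ transᵉ (suc ∘ ρ) (suc ∘ κ) e) [ !ᵖ := box (transᵛ ρ κ w) ] ↦_)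
    -- Only on the side of `e`, where `x` does not occur, is the substitution eliminated by an
    -- equation; on `V` it is left to `v≃`.
    (cong₂ _♯_
      (cong (sub _ _) (ren-transᵛ _ (lift-cong (λ _ → refl)) (λ _ → refl) v))
      (trans (cong (sub _ _) (ren-transᵉ _ (λ _ → refl) (λ _ → refl) e))
             (sub-transᵉ (λ _ → refl) (λ _ → refl) e)))
    (β-box ρ κ (V ♯ transᵉ (suc ∘ ρ) (suc ∘ κ) e) w)
  v≃ = ≃-♯ split-∅ (≃-transᵛ (Simulates-[x] ⊢w) I ⊢v) (≃-refl (⊢transᵉ I ⊢e))

-- Steps inside `v · e` take place under the weakenings of `bang`. Passing to `core` turns these
-- into a larger linear scope, where the induction hypothesis applies since `l` is arbitrary.
↠-transᵛ : ∀ {ρ : Fin n → Fin m} {κ : Fin k → Fin m} {v v′} → Interp Δ ρ κ Ξ Θ →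
           Ξ ⊢ v ∶ T ∣ Θ → v ⟶ᵛ v′ → Δ ⨾ ∅ {l} ⊢ transᵛ ρ κ v ↠ transᵛ ρ κ v′ ∶ ¿ (T ᵀ)
↠-transᵉ : ∀ {ρ : Fin n → Fin m} {κ : Fin k → Fin m} {e e′} → Interp Δ ρ κ Ξ Θ →
           Ξ ∣ e ∶ T ⊢ Θ → e ⟶ᵉ e′ → Δ ⨾ ∅ {l} ⊢ transᵉ ρ κ e ↠ transᵉ ρ κ e′ ∶ ! (T ᵀ ^⊥)
↠-transᶜ : ∀ {ρ : Fin n → Fin m} {κ : Fin k → Fin m} {c c′} → Interp Δ ρ κ Ξ Θ →
           c ∶[ Ξ ⊢ Θ ] → c ⟶ᶜ c′ → Δ ⨾ ∅ {l} ⊢ transᶜ ρ κ c ↠ transᶜ ρ κ c′ ∶ ⊥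
↠-core   : ∀ {ρ : Fin n → Fin m} {κ : Fin k → Fin m} {e e′} → Interp Δ ρ κ Ξ Θ →
           Ξ ∣ e ∶ T ⊢ Θ → e ⟶ᵉ e′ → Δ ⨾ ∅ {l} ⊢ core ρ κ e ↠ core ρ κ e′ ∶ T ᵀ ^⊥
↠-transᵛ I (μ c) (μ r) = ↠-map ¿·_ ξ¿ (↠-transᶜ (Interp-μ I) c r)
↠-transᵛ I (ƛ v) (ƛ r) = ↠-map fun (ξfun _ _ _) (↠-transᵛ (Interp-ƛ I) v r)
↠-transᵉ {e = e} {e′} I ⊢e r =
  subst₂ (λ t s → _ ⨾ ∅ ⊢ t ↠ s ∶ _) (sym (transᵉ-box e)) (sym (transᵉ-box e′))
    (↠-map box ξbox (↠-core I ⊢e r))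
↠-transᶜ I ⟨ ƛ v ∣ w · e ⟩ β       = ↠-β I v w e
↠-transᶜ I ⟨ μ c ∣ e ⟩     μ       = ↠-μ I c e
↠-transᶜ I ⟨ v ∣ e ⟩       (⟨⟩ˡ r) =
  ↠-map (_♯ _) (λ r → ξ♯ˡ split-∅ r (⊢transᵉ I e)) (↠-transᵛ I v r)
↠-transᶜ I ⟨ v ∣ e ⟩       (⟨⟩ʳ r) =
  ↠-map (_ ♯_) (ξ♯ʳ split-∅ (⊢transᵛ I v)) (↠-transᵉ I e r)
↠-core {Δ = Δ} I (_·_ {S = S} v e) (·ˡ r) =
  ↠-map ⟨_, _ ⟩ (λ r → ξpairˡ split-∅ r (⊢transᵉ I e))
    (↠-map box ξbox (subst (λ A → Δ ⨾ ∅ ⊢ _ ↠ _ ∶ ¿ A) (sym (^⊥-involutive (S ᵀ)))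
      (↠-transᵛ I v r)))
↠-core I (_·_ {S = S} v e) (·ʳ r) =
  ↠-map ⟨ _ ,_⟩ (ξpairʳ split-∅
    (⊢box (⊢-type (cong ¿_ (sym (^⊥-involutive (S ᵀ)))) (⊢transᵛ I v)))) (↠-transᵉ I e r)

Interp-envᵀ : (Ξ : Vec Type n) (Θ : Vec Type k) → Interp (envᵀ Ξ Θ) (_↑ˡ k) (n ↑ʳ_) Ξ Θ
Interp-envᵀ Ξ Θ .var-type x   =
  trans (lookup-++ˡ (map (λ T → ¿ (T ᵀ)) Ξ) _ x) (lookup-map x _ Ξ)
Interp-envᵀ Ξ Θ .covar-type γ =
  trans (lookup-++ʳ (map (λ T → ¿ (T ᵀ)) Ξ) _ γ) (lookup-map γ _ Θ)

proposition25 : {n k : ℕ} {Γ : Vec Type n} {Θ : Vec Type k} →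
    ({T : Type} {v v′ : Term n k} → Γ ⊢ v ∶ T ∣ Θ → v ⟶ᵛ v′ →
    envᵀ Γ Θ ⨾ ∅ ⊢ v ᵀᵛ ↠ v′ ᵀᵛ ∶ ¿ (T ᵀ)) ×
    ({T : Type} {e e′ : CoTerm n k} → Γ ∣ e ∶ T ⊢ Θ → e ⟶ᵉ e′ →
    envᵀ Γ Θ ⨾ ∅ ⊢ e ᵀᵉ ↠ e′ ᵀᵉ ∶ ! (T ᵀ ^⊥)) ×
    ({c c′ : Cmd n k} → c ∶[ Γ ⊢ Θ ] → c ⟶ᶜ c′ →
    envᵀ Γ Θ ⨾ ∅ ⊢ c ᵀᶜ ↠ c′ ᵀᶜ ∶ ⊥)
proposition25 {Γ = Γ} {Θ} = ↠-transᵛ I , ↠-transᵉ I , ↠-transᶜ I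
  where I = Interp-envᵀ Γ Θ
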